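{- Let $|N|\ge 2$, $x\in N$, $M:=N\setminus x$ and $r\in\mathbb{R}^{\mathcal{P}(M)}$. Let $m=T_{\ell\text{ -mod}}(r)\in\mathbb{R}^{\mathcal{P}(N)}$ be the lower modular extension of $r$. (i) One has $m\in\mathcal{K}(N)$ if and only if $r\in\mathcal{K}(M)$. The independency model induced by $m$ is then determined as follows: given $\langle a,b|C\rangle\in\mathcal{E}(N)$, one has $a\perp b\mid C\ [m]$ if and only if one of the following holds: - $x\notin a\cup b\cup C$; - $x\in\{a,b\}$ and $r_\ell((a\cup b\cup C)\setminus x)=r_\ell(C)$; - $x\in C$ and $a\perp b\mid (C\setminus x)\ [r]$. (ii) The function $r$ is extreme in $\mathcal{K}(M)$ if and only if $m=T_{\ell\text{ -mod}}(r)$ is extreme in $\mathcal{K}(N)$.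
   Context: $N$ is a finite set and $\mathcal{P}(N)$ is its power set; a singleton $\{a\}$ is written $a$. $\mathbb{R}^{\mathcal{P}(N)}$ is the space of functions $m:\mathcal{P}(N)\to\mathbb{R}$ with scalar product $\langle m,u\rangle=\sum_{A\subseteq N}m(A)u(A)$. A function $m$ is supermodular if $m(A)+m(B)\le m(A\cup B)+m(A\cap B)$ for all $A,B\subseteq N$; $\mathcal{K}(N)$ is the cone of supermodular functions. $\mathcal{E}(N)$ is the set of triplets $\langle a,b|C\rangle$ with $a,b\in N$ distinct and $C\subseteq N\setminus\{a,b\}$. For $m\in\mathbb{R}^{\mathcal{P}(N)}$, $a\perp b\mid C\ [m]$ means $m(a\cup b\cup C)+m(C)-m(a\cup C)-m(b\cup C)=0$; the independency model induced by $m\in\mathcal{K}(N)$ is the set of $\langle a,b|C\rangle\in\mathcal{E}(N)$ with $a\perp b\mid C\ [m]$. A face of a convex cone $K\subseteq\mathbb{R}^{\mathcal{P}(N)}$ is a set $\{m\in K: k=\langle m,v\rangle\}$, where $v\in\mathbb{R}^{\mathcal{P}(N)}$, $k\in\mathbb{R}$ satisfy $k\le\langle m,v\rangle$ for all $m\in K$. The non-empty faces of $\mathcal{K}(N)$ form a lattice under inclusion with least element the space of modular functions $\mathcal{K}(N)\cap(-\mathcal{K}(N))$. A function is extreme in $\mathcal{K}(N)$ if it belongs to $\mathcal{K}(N)$ and the smallest face of $\mathcal{K}(N)$ containing it is an atom of this lattice. The same definitions are used for other finite sets in place of $N$. For $r\in\mathbb{R}^{\mathcal{P}(M)}$ the lower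 standardization is $r_\ell(T)=r(T)-r(\emptyset)+\sum_{i\in T}[r(\emptyset)-r(i)]$ for $T\subseteq M$. For $\emptyset\ne M\subsetneq N$ the lower modular extension $T_{\ell\text{ -mod}}:\mathbb{R}^{\mathcal{P}(M)}\to\mathbb{R}^{\mathcal{P}(N)}$ is defined, for $S\subseteq N$, by $[T_{\ell\text{ -mod}}(r)](S)=r(S\cap M)$ if $N\setminus M\subseteq S$, and $[T_{\ell\text{ -mod}}(r)](S)=r(S\cap M)-r_\ell(S\cap M)$ otherwise. -}

module Defs where

open import Data.Bool.Base using (if_then_else_)
open import Data.Fin.Base using (Fin)
open import Data.Fin.Subset as Sub using (Subset; inside; outside; _∈_; _∉_; _⊆_; _─_)
open import Data.Fin.Subset.Properties
  using (_∈?_; _⊆?_; ⊥⊆; x∈⁅y⁆⇒x≡y; p∩q⊆p; p∩q⊆q; x∈p∪q⁻; x∈p∧x∉q⇒x∈p─q)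
open import Data.Irrelevant as Irrelevant using ([_])
open import Data.Nat.Base as ℕ using (ℕ; zero; suc)
import Data.Nat.Properties as ℕ
open import Data.Product.Base using (∃-syntax; Σ-syntax; _×_; _,_)
open import Data.Rational.Base as ℚ using (ℚ; Positive; 0ℚ; 1ℚ; ½; ∣_∣)
import Data.Rational.Properties as ℚ
open import Data.Rational.Solver using (module +-*-Solver)
open import Data.Refinement using (Refinement-syntax; _,_; value; proof)
open import Data.Sum.Base using (_⊎_; inj₁; inj₂; [_,_]′)
open import Data.Vec.Base using ([]; _∷_)
open import Data.Vec.Functional using (foldr)
open import Level using (0ℓ)
open import Relation.Binary.PropositionalEquality
  using (_≡_; _≢_; refl; sym; trans; cong; subst)
open import Relation.Nullary using (¬_; Dec; yes; no; does)
open import Relation.Unary as Pred using (Pred; _≐_)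

------------------------------------------------------------------------
-- The real numbers, as Cauchy sequences of rationals with the setoid
-- equality _≈_ ("the difference tends to 0"). The proofs that sums,
-- negations and products are again Cauchy are abstract; the sequences
-- themselves compute termwise.

IsSettled : (ℕ → ℚ) → ℚ → Set
IsSettled s ε = ∃[ k ] ∀ i j → k ℕ.≤ i → k ℕ.≤ j → ∣ s i ℚ.- s j ∣ ℚ.≤ ε

IsCauchy : (ℕ → ℚ) → Set
IsCauchy s = ∀ ε → .{{Positive ε}} → IsSettled s ε

record ℝ : Set where
  constructor mkℝ
  field
    seq    : ℕ → ℚ
    cauchy : IsCauchy seq
open ℝ public

infix  4 _≈_ _≤_
infixl 6 _+_ _-_
infixl 7 _*_
infix  8 -_

record _≈_ (x y : ℝ) : Set where
  constructor mk≈
  field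
    eventually-close : ∀ ε → .{{Positive ε}} →
      ∃[ k ] ∀ i → k ℕ.≤ i → ∣ seq x i ℚ.- seq y i ∣ ℚ.≤ ε
open _≈_ public

record _≤_ (x y : ℝ) : Set where
  constructor mk≤
  field
    eventually-below : ∀ ε → .{{Positive ε}} →
      ∃[ k ] ∀ i → k ℕ.≤ i → seq x i ℚ.≤ seq y i ℚ.+ ε
open _≤_ public

0ℝ : ℝ
0ℝ = mkℝ (λ _ → 0ℚ) λ ε → 0 , λ _ _ _ _ → ℚ.<⇒≤ (ℚ.positive⁻¹ ε)

private
  ε/2+ε/2 : ∀ ε → ½ ℚ.* ε ℚ.+ ½ ℚ.* ε ≡ ε
  ε/2+ε/2 = solve 1 (λ ε → con ½ :* ε :+ con ½ :* ε := ε) refl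
    where open +-*-Solver

  regroup-+ : ∀ a b c d → (a ℚ.+ b) ℚ.- (c ℚ.+ d) ≡ (a ℚ.- c) ℚ.+ (b ℚ.- d)
  regroup-+ = solve 4 (λ a b c d → (a :+ b) :- (c :+ d) := (a :- c) :+ (b :- d)) refl
    where open +-*-Solver

  regroup-* : ∀ a b c d → a ℚ.* b ℚ.- c ℚ.* d ≡ a ℚ.* (b ℚ.- d) ℚ.+ d ℚ.* (a ℚ.- c)
  regroup-* = solve 4 (λ a b c d → a :* b :- c :* d := a :* (b :- d) :+ d :* (a :- c)) refl
    where open +-*-Solver

  regroup-neg : ∀ a b → (ℚ.- a) ℚ.- (ℚ.- b) ≡ ℚ.- (a ℚ.- b)
  regroup-neg = solve 2 (λ a b → (:- a) :- (:- b) := :- (a :- b)) refl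
    where open +-*-Solver

  split : ∀ a b → a ≡ (a ℚ.- b) ℚ.+ b
  split = solve 2 (λ a b → a := (a :- b) :+ b) refl
    where open +-*-Solver

  Bound : ℝ → Set
  Bound x = ∃[ B ] Positive B × (∃[ k ] ∀ i → k ℕ.≤ i → ∣ seq x i ∣ ℚ.≤ B)

  eventually-bounded : (x : ℝ) → Bound x
  eventually-bounded x with cauchy x 1ℚ
  ... | k , h = 1ℚ ℚ.+ ∣ seq x k ∣ , B>0 , k , bound
    where
    B>0 : Positive (1ℚ ℚ.+ ∣ seq x k ∣)
    B>0 = ℚ.positive (ℚ.+-mono-<-≤ (ℚ.positive⁻¹ 1ℚ) (ℚ.0≤∣p∣ (seq x k)))
    bound : ∀ i → k ℕ.≤ i → ∣ seq x i ∣ ℚ.≤ 1ℚ ℚ.+ ∣ seq x k ∣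
    bound i k≤i = begin
      ∣ seq x i ∣                             ≡⟨ cong ∣_∣ (split (seq x i) (seq x k)) ⟩
      ∣ (seq x i ℚ.- seq x k) ℚ.+ seq x k ∣   ≤⟨ ℚ.∣p+q∣≤∣p∣+∣q∣ (seq x i ℚ.- seq x k) (seq x k) ⟩
      ∣ seq x i ℚ.- seq x k ∣ ℚ.+ ∣ seq x k ∣ ≤⟨ ℚ.+-monoˡ-≤ ∣ seq x k ∣ (h i k k≤i ℕ.≤-refl) ⟩
      1ℚ ℚ.+ ∣ seq x k ∣                      ∎
      where open ℚ.≤-Reasoning

  ∣*∣-mono : ∀ p q B δ → .{{Positive B}} → ∣ p ∣ ℚ.≤ B → ∣ q ∣ ℚ.≤ δ →
             ∣ p ℚ.* q ∣ ℚ.≤ B ℚ.* δ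
  ∣*∣-mono p q B δ p≤B q≤δ = begin
    ∣ p ℚ.* q ∣     ≡⟨ ℚ.∣p*q∣≡∣p∣*∣q∣ p q ⟩
    ∣ p ∣ ℚ.* ∣ q ∣ ≤⟨ ℚ.*-monoʳ-≤-nonNeg ∣ q ∣ {{ℚ.∣-∣-nonNeg q}} p≤B ⟩
    B ℚ.* ∣ q ∣     ≤⟨ ℚ.*-monoˡ-≤-nonNeg B {{ℚ.pos⇒nonNeg B}} q≤δ ⟩
    B ℚ.* δ         ∎
    where open ℚ.≤-Reasoning

abstract
  private
    +-cauchy : (x y : ℝ) → IsCauchy (λ i → seq x i ℚ.+ seq y i)
    +-cauchy x y ε with cauchy x (½ ℚ.* ε) {{ℚ.pos*pos⇒pos ½ ε}}
                      | cauchy y (½ ℚ.* ε) {{ℚ.pos*pos⇒pos ½ ε}}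
    ... | k , h | l , g = k ℕ.⊔ l , λ i j p q → begin
      ∣ (seq x i ℚ.+ seq y i) ℚ.- (seq x j ℚ.+ seq y j) ∣
        ≡⟨ cong ∣_∣ (regroup-+ (seq x i) (seq y i) (seq x j) (seq y j)) ⟩
      ∣ (seq x i ℚ.- seq x j) ℚ.+ (seq y i ℚ.- seq y j) ∣
        ≤⟨ ℚ.∣p+q∣≤∣p∣+∣q∣ (seq x i ℚ.- seq x j) (seq y i ℚ.- seq y j) ⟩
      ∣ seq x i ℚ.- seq x j ∣ ℚ.+ ∣ seq y i ℚ.- seq y j ∣
        ≤⟨ ℚ.+-mono-≤ (h i j (ℕ.m⊔n≤o⇒m≤o k l p) (ℕ.m⊔n≤o⇒m≤o k l q))
                      (g i j (ℕ.m⊔n≤o⇒n≤o k l p) (ℕ.m⊔n≤o⇒n≤o k l q)) ⟩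
      ½ ℚ.* ε ℚ.+ ½ ℚ.* ε
        ≡⟨ ε/2+ε/2 ε ⟩
      ε ∎
      where open ℚ.≤-Reasoning

    neg-cauchy : (x : ℝ) → IsCauchy (λ i → ℚ.- seq x i)
    neg-cauchy x ε with cauchy x ε
    ... | k , h = k , λ i j p q → subst (ℚ._≤ ε)
      (sym (trans (cong ∣_∣ (regroup-neg (seq x i) (seq x j))) (ℚ.∣-p∣≡∣p∣ (seq x i ℚ.- seq x j))))
      (h i j p q)

_+_ : ℝ → ℝ → ℝ
x + y = mkℝ (λ i → seq x i ℚ.+ seq y i) (+-cauchy x y)

-_ : ℝ → ℝ
- x = mkℝ (λ i → ℚ.- seq x i) (neg-cauchy x)

_-_ : ℝ → ℝ → ℝ
x - y = x + - y

private
  divide : ∀ s ε → Positive s → .{{Positive ε}} → ∃[ δ ] Positive δ × (s ℚ.* δ ≡ ε)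
  divide s ε s>0 =
    ℚ.1/ s ℚ.* ε ,
    ℚ.pos*pos⇒pos (ℚ.1/ s) {{ℚ.1/pos⇒pos s}} ε ,
    trans (sym (ℚ.*-assoc s (ℚ.1/ s) ε))
      (trans (cong (ℚ._* ε) (ℚ.*-inverseʳ s)) (ℚ.*-identityˡ ε))
    where
    instance
      _ = s>0
      s≢0 : ℚ.NonZero s
      s≢0 = ℚ.pos⇒nonZero s

  *-close : ∀ {B C δ ε} → Positive B → Positive C → (B ℚ.+ C) ℚ.* δ ≡ ε →
            ∀ a b c d → ∣ a ∣ ℚ.≤ B → ∣ d ∣ ℚ.≤ C →
            ∣ a ℚ.- c ∣ ℚ.≤ δ → ∣ b ℚ.- d ∣ ℚ.≤ δ →
            ∣ a ℚ.* b ℚ.- c ℚ.* d ∣ ℚ.≤ ε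
  *-close {B} {C} {δ} {ε} B>0 C>0 eq a b c d a≤B d≤C a-c≤δ b-d≤δ = begin
    ∣ a ℚ.* b ℚ.- c ℚ.* d ∣
      ≡⟨ cong ∣_∣ (regroup-* a b c d) ⟩
    ∣ a ℚ.* (b ℚ.- d) ℚ.+ d ℚ.* (a ℚ.- c) ∣
      ≤⟨ ℚ.∣p+q∣≤∣p∣+∣q∣ (a ℚ.* (b ℚ.- d)) (d ℚ.* (a ℚ.- c)) ⟩
    ∣ a ℚ.* (b ℚ.- d) ∣ ℚ.+ ∣ d ℚ.* (a ℚ.- c) ∣
      ≤⟨ ℚ.+-mono-≤ (∣*∣-mono a (b ℚ.- d) B δ {{B>0}} a≤B b-d≤δ)
                    (∣*∣-mono d (a ℚ.- c) C δ {{C>0}} d≤C a-c≤δ) ⟩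
    B ℚ.* δ ℚ.+ C ℚ.* δ
      ≡⟨ ℚ.*-distribʳ-+ δ B C ⟨
    (B ℚ.+ C) ℚ.* δ
      ≡⟨ eq ⟩
    ε ∎
    where open ℚ.≤-Reasoning

abstract
  private
    *-cauchy : (x y : ℝ) → IsCauchy (λ i → seq x i ℚ.* seq y i)
    *-cauchy x y ε = step₁ ε (eventually-bounded x) (eventually-bounded y)
      where
      step₃ : ∀ {ε δ} ((B , _) : Bound x) ((C , _) : Bound y) → (B ℚ.+ C) ℚ.* δ ≡ ε →
              IsSettled (seq x) δ → IsSettled (seq y) δ → IsSettled (λ i → seq x i ℚ.* seq y i) ε
      step₃ (B , B>0 , k₁ , b) (C , C>0 , k₂ , c) eq (k₃ , h) (k₄ , g) =
        (k₁ ℕ.⊔ k₂) ℕ.⊔ (k₃ ℕ.⊔ k₄) , λ i j p q →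
        *-close B>0 C>0 eq (seq x i) (seq y i) (seq x j) (seq y j)
          (b i (ℕ.m⊔n≤o⇒m≤o k₁ k₂ (left p)))
          (c j (ℕ.m⊔n≤o⇒n≤o k₁ k₂ (left q)))
          (h i j (ℕ.m⊔n≤o⇒m≤o k₃ k₄ (right p)) (ℕ.m⊔n≤o⇒m≤o k₃ k₄ (right q)))
          (g i j (ℕ.m⊔n≤o⇒n≤o k₃ k₄ (right p)) (ℕ.m⊔n≤o⇒n≤o k₃ k₄ (right q)))
        where
        left : ∀ {i} → (k₁ ℕ.⊔ k₂) ℕ.⊔ (k₃ ℕ.⊔ k₄) ℕ.≤ i → k₁ ℕ.⊔ k₂ ℕ.≤ i
        left = ℕ.m⊔n≤o⇒m≤o (k₁ ℕ.⊔ k₂) (k₃ ℕ.⊔ k₄)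
        right : ∀ {i} → (k₁ ℕ.⊔ k₂) ℕ.⊔ (k₃ ℕ.⊔ k₄) ℕ.≤ i → k₃ ℕ.⊔ k₄ ℕ.≤ i
        right = ℕ.m⊔n≤o⇒n≤o (k₁ ℕ.⊔ k₂) (k₃ ℕ.⊔ k₄)

      step₂ : ∀ {ε} (bx@(B , _) : Bound x) (by@(C , _) : Bound y) →
              ∃[ δ ] Positive δ × ((B ℚ.+ C) ℚ.* δ ≡ ε) → IsSettled (λ i → seq x i ℚ.* seq y i) ε
      step₂ bx by (δ , δ>0 , eq) =
        step₃ bx by eq (cauchy x δ {{δ>0}}) (cauchy y δ {{δ>0}})

      step₁ : ∀ ε → .{{Positive ε}} → Bound x → Bound y → IsSettled (λ i → seq x i ℚ.* seq y i) ε
      step₁ ε bx@(B , B>0 , _) by@(C , C>0 , _) =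
        step₂ bx by (divide (B ℚ.+ C) ε (ℚ.pos+pos⇒pos B {{B>0}} C {{C>0}}))

_*_ : ℝ → ℝ → ℝ
x * y = mkℝ (λ i → seq x i ℚ.* seq y i) (*-cauchy x y)

------------------------------------------------------------------------
-- Ground sets and set functions. A finite set is a subset N of some
-- Fin n, so that N and N ∖ x are objects of the same kind. Membership
-- proofs are irrelevant, so elements of 𝒫 N are equal (_≡_) as soon as
-- their underlying subsets are.

Element : ∀ {n} → Subset n → Set
Element {n} N = [ i ∈ Fin n ∣ i ∈ N ]

𝒫 : ∀ {n} → Subset n → Set
𝒫 {n} N = [ S ∈ Subset n ∣ S ⊆ N ]

SetFunction : ∀ {n} → Subset n → Set
SetFunction N = 𝒫 N → ℝ

infixl 6 _∪_
infixl 7 _∩_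

∅ : ∀ {n} {N : Subset n} → 𝒫 N
∅ = Sub.⊥ , [ ⊥⊆ ]

⁅_⁆ : ∀ {n} {N : Subset n} → Element N → 𝒫 N
⁅_⁆ {N = N} (i , i∈N) =
  Sub.⁅ i ⁆ , Irrelevant.map (λ p {j} q → subst (_∈ N) (sym (x∈⁅y⁆⇒x≡y i q)) p) i∈N

_∪_ : ∀ {n} {N : Subset n} → 𝒫 N → 𝒫 N → 𝒫 N
(A , [ p ]) ∪ (B , [ q ]) = A Sub.∪ B , [ (λ i∈ → [ p , q ]′ (x∈p∪q⁻ A B i∈)) ]

_∩_ : ∀ {n} {N : Subset n} → 𝒫 N → 𝒫 N → 𝒫 N
(A , [ p ]) ∩ (B , _) = A Sub.∩ B , [ (λ i∈ → p (p∩q⊆p A B i∈)) ]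

-- S ↾ M is S ∩ M, as an element of 𝒫 M.
_↾_ : ∀ {n} {N : Subset n} → 𝒫 N → (M : Subset n) → 𝒫 M
(S , _) ↾ M = S Sub.∩ M , [ p∩q⊆q S M ]

ifTrue : {P : Set} → Dec P → (.P → ℝ) → ℝ
ifTrue (yes p) f = f p
ifTrue (no _)  f = 0ℝ

∑Subset : ∀ {n} → (Subset n → ℝ) → ℝ
∑Subset {zero}  f = f []
∑Subset {suc n} f = ∑Subset (λ A → f (outside ∷ A)) + ∑Subset (λ A → f (inside ∷ A))

∑∈ : ∀ {n} (T : Subset n) → ((i : Fin n) → .(i ∈ T) → ℝ) → ℝ
∑∈ T f = foldr _+_ 0ℝ (λ i → ifTrue (i ∈? T) (f i))

∑𝒫 : ∀ {n} (N : Subset n) → SetFunction N → ℝ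
∑𝒫 N f = ∑Subset (λ A → ifTrue (A ⊆? N) (λ p → f (A , [ p ])))

⟨_,_⟩ : ∀ {n} {N : Subset n} → SetFunction N → SetFunction N → ℝ
⟨_,_⟩ {N = N} m u = ∑𝒫 N (λ A → m A * u A)

------------------------------------------------------------------------
-- Supermodular and modular functions

𝒦 : ∀ {n} (N : Subset n) → Pred (SetFunction N) 0ℓ
𝒦 N m = ∀ (A B : 𝒫 N) → m A + m B ≤ m (A ∪ B) + m (A ∩ B)

Modular : ∀ {n} (N : Subset n) → Pred (SetFunction N) 0ℓ
Modular N m = 𝒦 N m × 𝒦 N (λ S → - m S)

------------------------------------------------------------------------
-- Triplets ⟨a,b|C⟩ and conditional independence

record ℰ {n} (N : Subset n) : Set where
  field
    a b : Element N
    C   : 𝒫 N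
    a≢b : value a ≢ value b
    a∉C : value a ∉ value C
    b∉C : value b ∉ value C

  abC : 𝒫 N
  abC = ⁅ a ⁆ ∪ ⁅ b ⁆ ∪ C

-- t ∈ℐ m  is  a ⊥ b | C [m]  for t = ⟨a,b|C⟩.
_∈ℐ_ : ∀ {n} {N : Subset n} → ℰ N → SetFunction N → Set
t ∈ℐ m = m abC + m C - m (⁅ a ⁆ ∪ C) - m (⁅ b ⁆ ∪ C) ≈ 0ℝ
  where open ℰ t

-- For x ∈ C, the triplet ⟨a,b|C∖x⟩ over N ∖ x.
dropFromC : ∀ {n} {N : Subset n} (x : Fin n) (t : ℰ N) →
            x ∈ value (ℰ.C t) → ℰ (N ─ Sub.⁅ x ⁆)
dropFromC {N = N} x t x∈C = record
  { a   = value a , Irrelevant.map (avoid a∉C) (proof a)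
  ; b   = value b , Irrelevant.map (avoid b∉C) (proof b)
  ; C   = C ↾ (N ─ Sub.⁅ x ⁆)
  ; a≢b = a≢b
  ; a∉C = λ q → a∉C (p∩q⊆p (value C) _ q)
  ; b∉C = λ q → b∉C (p∩q⊆p (value C) _ q)
  }
  where
  open ℰ t
  avoid : ∀ {i} → i ∉ value C → i ∈ N → i ∈ N ─ Sub.⁅ x ⁆
  avoid i∉C i∈N = x∈p∧x∉q⇒x∈p─q i∈N
    (λ q → i∉C (subst (_∈ value C) (sym (x∈⁅y⁆⇒x≡y x q)) x∈C))

------------------------------------------------------------------------
-- Faces and extreme functions

-- A face is presented by data (v , k) cutting it out; as a set it is its
-- carrier, and faces are compared through their carriers.
record Face {n} {N : Subset n} (K : Pred (SetFunction N) 0ℓ) : Set where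
  field
    v     : SetFunction N
    k     : ℝ
    valid : ∀ m → K m → k ≤ ⟨ m , v ⟩

  carrier : Pred (SetFunction N) 0ℓ
  carrier m = K m × k ≈ ⟨ m , v ⟩
open Face public using (carrier)

NonEmpty : ∀ {n} {N : Subset n} {K : Pred (SetFunction N) 0ℓ} → Face K → Set
NonEmpty F = ∃[ m ] carrier F m

-- Atoms of the lattice of non-empty faces of 𝒦 N, whose least element
-- is the set of modular functions.
IsAtom : ∀ {n} {N : Subset n} → Face (𝒦 N) → Set
IsAtom {N = N} F =
    NonEmpty F
  × ¬ (carrier F ≐ Modular N)
  × (∀ (G : Face (𝒦 N)) → NonEmpty G → carrier G Pred.⊆ carrier F →
       carrier G ≐ Modular N ⊎ carrier G ≐ carrier F)

IsSmallestFaceContaining : ∀ {n} {N : Subset n} → SetFunction N → Face (𝒦 N) → Set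
IsSmallestFaceContaining {N = N} m F =
  carrier F m × (∀ (G : Face (𝒦 N)) → carrier G m → carrier F Pred.⊆ carrier G)

Extreme : ∀ {n} (N : Subset n) → Pred (SetFunction N) 0ℓ
Extreme N m =
  𝒦 N m × (Σ[ F ∈ Face (𝒦 N) ] IsSmallestFaceContaining m F × IsAtom F)

------------------------------------------------------------------------
-- Lower standardization and lower modular extension

lowerStandardization : ∀ {n} {M : Subset n} → SetFunction M → SetFunction M
lowerStandardization r T@(S , [ S⊆M ]) =
  r T - r ∅ + ∑∈ S (λ i i∈S → r ∅ - r ⁅ i , [ S⊆M i∈S ] ⁆)

-- T_ℓ-mod, intended for ∅ ≠ M ⊊ N (the formula itself needs no such
-- proviso).
lowerModularExtension : ∀ {n} {M N : Subset n} → SetFunction M → SetFunction N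
lowerModularExtension {M = M} {N} r S =
  if does (N ─ M ⊆? value S)
  then r (S ↾ M)
  else r (S ↾ M) - lowerStandardization r (S ↾ M)

{-# OPTIONS --safe #-}
-- Write T r for the lower modular extension and R m for the function
-- S ↦ m (S ∪ x) on 𝒫 M, so that R (T r) = r; both maps are linear and
-- preserve supermodularity. Below M, T r is the modular function agreeing
-- with r on ∅ and on singletons. Hence T r increases from S to S ∪ x by the
-- lower standardization of r at S, which is monotone when r is
-- supermodular, and part (i) follows.
--
-- For part (ii), a linear functional Φ, nonnegative on 𝒦 N, satisfies
-- Φ (T r) = 0, and Φ m = 0 makes m − T (R m) modular. So the face Φ = 0 is
-- T (𝒦 M) up to modular functions. A face of 𝒦 N pulls back along T; a face
-- ⟨ r , v ⟩ = k of 𝒦 M lifts to ⟨ R m , v ⟩ + Φ m = k. Every nonempty face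
-- absorbs modular functions, so on faces below Φ = 0 these two operations
-- are mutually inverse, and atoms correspond to atoms. The alternative in
-- IsAtom is only transported, never decided, so no excluded middle is needed.
module Submission where

open import Defs
open import Algebra.Bundles using (CommutativeMonoid; CommutativeRing)
import Algebra.Properties.CommutativeMonoid.Sum as Summation
import Algebra.Properties.CommutativeSemigroup as CommutativeSemigroupProperties
import Algebra.Solver.Ring as RingSolver
open import Algebra.Solver.Ring.AlmostCommutativeRing
  using (fromCommutativeRing; _-Raw-AlmostCommutative⟶_)
open import Algebra.Structures using (IsCommutativeRing)
open import Data.Bool.Base using (true; false; if_then_else_)
import Data.Bool.Properties as Bool
open import Data.Empty using (⊥-elim)
open import Data.Empty.Irrelevant renaming (⊥-elim to ⊥-elim-irr)
open import Data.Fin.Base using (Fin; zero; suc)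
import Data.Fin.Properties as Fin
open import Data.Fin.Subset using (Subset; _∈_; _∉_; ∣_∣) renaming (_-_ to _∖_)
open import Data.Fin.Subset as Sub using (_⊆_; _─_; inside; outside)
open import Data.Fin.Subset.Properties
open import Data.Irrelevant using ([_])
open import Data.Maybe.Base as Maybe using (Maybe)
open import Data.Nat.Base using (ℕ; zero; suc) renaming (_≤_ to _≤ℕ_)
import Data.Nat.Base as ℕ
import Data.Nat.Properties as ℕ
open import Data.Product.Base using (Σ-syntax; ∃-syntax; _×_; _,_; proj₁; proj₂)
open import Data.Rational.Base as ℚ using (ℚ; Positive; 0ℚ; 1ℚ; ½)
import Data.Rational.Properties as ℚ
import Data.Rational.Solver as ℚ
open import Data.Refinement using (value; _,_)
open import Data.Sum.Base as Sum using (_⊎_; inj₁; inj₂; [_,_]′)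
open import Data.Vec.Base using ([]; _∷_; here; there)
open import Data.Vec.Functional using (foldr)
open import Data.Vec.Properties using (≡-dec)
open import Function.Base using (_∘_; id)
open import Function.Bundles using (_⇔_; mk⇔; Equivalence)
open import Level using (0ℓ)
open import Relation.Binary.Definitions using (DecidableEquality)
open import Relation.Binary.PropositionalEquality
  using (_≡_; _≢_; refl; sym; trans; cong; cong₂; subst; subst₂)
import Relation.Binary.Reasoning.Setoid as ≈-Reasoning
open import Relation.Binary.Structures using (IsEquivalence)
open import Relation.Nullary using (¬_; Dec; yes; no; does)
open import Relation.Nullary.Decidable using (dec⇒maybe; dec-true; dec-false; recompute)
open import Relation.Unary as Pred using (_≐_)

-- Real numbers

private
  module _ where
    open ℚ.+-*-Solver

    half+half : ∀ ε → ½ ℚ.* ε ℚ.+ ½ ℚ.* ε ≡ ε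
    half+half = solve 1 (λ ε → con ½ :* ε :+ con ½ :* ε := ε) refl

    -[-p]≡p : ∀ p → ℚ.- (ℚ.- p) ≡ p
    -[-p]≡p = solve 1 (λ p → :- (:- p) := p) refl

    q-p≡-p--q : ∀ p q → q ℚ.- p ≡ ℚ.- p ℚ.- ℚ.- q
    q-p≡-p--q = solve 2 (λ p q → q :- p := :- p :- :- q) refl

    p≡q+[p-q] : ∀ p q → p ≡ q ℚ.+ (p ℚ.- q)
    p≡q+[p-q] = solve 2 (λ p q → p := q :+ (p :- q)) refl

    [q+ε]-q≡ε : ∀ q ε → (q ℚ.+ ε) ℚ.- q ≡ ε
    [q+ε]-q≡ε = solve 2 (λ q ε → (q :+ ε) :- q := ε) refl

    -[p-q]≡q-p : ∀ p q → ℚ.- (p ℚ.- q) ≡ q ℚ.- p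
    -[p-q]≡q-p = solve 2 (λ p q → :- (p :- q) := q :- p) refl

    pr-qr≡r[p-q] : ∀ p q r → p ℚ.* r ℚ.- q ℚ.* r ≡ r ℚ.* (p ℚ.- q)
    pr-qr≡r[p-q] = solve 3 (λ p q r → p :* r :- q :* r := r :* (p :- q)) refl

    [p+q]+[ε+δ] : ∀ p q ε δ → (p ℚ.+ ε) ℚ.+ (q ℚ.+ δ) ≡ (p ℚ.+ q) ℚ.+ (ε ℚ.+ δ)
    [p+q]+[ε+δ] = solve 4 (λ p q ε δ → (p :+ ε) :+ (q :+ δ) := (p :+ q) :+ (ε :+ δ)) refl

  half-positive : ∀ ε → .{{Positive ε}} → Positive (½ ℚ.* ε)
  half-positive ε = ℚ.pos*pos⇒pos ½ ε

  ∣p-q∣≡∣q-p∣ : ∀ p q → ℚ.∣ p ℚ.- q ∣ ≡ ℚ.∣ q ℚ.- p ∣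
  ∣p-q∣≡∣q-p∣ p q = trans (sym (ℚ.∣-p∣≡∣p∣ (p ℚ.- q))) (cong ℚ.∣_∣ (-[p-q]≡q-p p q))

  p≤∣p∣ : ∀ p → p ℚ.≤ ℚ.∣ p ∣
  p≤∣p∣ p with ℚ.∣p∣≡p∨∣p∣≡-p p
  ... | inj₁ eq = ℚ.≤-reflexive (sym eq)
  ... | inj₂ eq = ℚ.≤-trans
    (subst (ℚ._≤ 0ℚ) (trans (cong ℚ.-_ eq) (-[-p]≡p p)) (ℚ.neg-antimono-≤ (ℚ.0≤∣p∣ p)))
    (ℚ.0≤∣p∣ p)

  ∣p-q∣≤ε⇒p≤q+ε : ∀ {p q ε} → ℚ.∣ p ℚ.- q ∣ ℚ.≤ ε → p ℚ.≤ q ℚ.+ ε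
  ∣p-q∣≤ε⇒p≤q+ε {p} {q} {ε} h = begin
    p                 ≡⟨ p≡q+[p-q] p q ⟩
    q ℚ.+ (p ℚ.- q)   ≤⟨ ℚ.+-monoʳ-≤ q (ℚ.≤-trans (p≤∣p∣ (p ℚ.- q)) h) ⟩
    q ℚ.+ ε           ∎
    where open ℚ.≤-Reasoning

  p≤q+ε⇒p-q≤ε : ∀ {p q ε} → p ℚ.≤ q ℚ.+ ε → p ℚ.- q ℚ.≤ ε
  p≤q+ε⇒p-q≤ε {p} {q} {ε} h =
    ℚ.≤-trans (ℚ.+-monoˡ-≤ (ℚ.- q) h) (ℚ.≤-reflexive ([q+ε]-q≡ε q ε))

  ∣p-q∣≤ε : ∀ {p q ε} → p ℚ.≤ q ℚ.+ ε → q ℚ.≤ p ℚ.+ ε → ℚ.∣ p ℚ.- q ∣ ℚ.≤ ε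
  ∣p-q∣≤ε {p} {q} {ε} h g with ℚ.∣p∣≡p∨∣p∣≡-p (p ℚ.- q)
  ... | inj₁ eq = subst (ℚ._≤ ε) (sym eq) (p≤q+ε⇒p-q≤ε h)
  ... | inj₂ eq = subst (ℚ._≤ ε) (sym (trans eq (-[p-q]≡q-p p q))) (p≤q+ε⇒p-q≤ε g)

≤-reflexive : ∀ {x y} → x ≈ y → x ≤ y
≤-reflexive (mk≈ h) = mk≤ λ ε → let k , g = h ε in
  k , λ i k≤i → ∣p-q∣≤ε⇒p≤q+ε (g i k≤i)

≤-antisym : ∀ {x y} → x ≤ y → y ≤ x → x ≈ y
≤-antisym (mk≤ h) (mk≤ g) = mk≈ λ ε → let k , p = h ε ; l , q = g ε in
  k ℕ.⊔ l , λ i k⊔l≤i → ∣p-q∣≤ε (p i (ℕ.m⊔n≤o⇒m≤o k l k⊔l≤i)) (q i (ℕ.m⊔n≤o⇒n≤o k l k⊔l≤i))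

≤-trans : ∀ {x y z} → x ≤ y → y ≤ z → x ≤ z
≤-trans {x} {y} {z} (mk≤ h) (mk≤ g) = mk≤ bound
  where
  bound : ∀ ε → .{{Positive ε}} → ∃[ k ] ∀ i → k ≤ℕ i → seq x i ℚ.≤ seq z i ℚ.+ ε
  bound ε = k ℕ.⊔ l , λ i k⊔l≤i → begin
    seq x i                            ≤⟨ p i (ℕ.m⊔n≤o⇒m≤o k l k⊔l≤i) ⟩
    seq y i ℚ.+ δ                      ≤⟨ ℚ.+-monoˡ-≤ δ (q i (ℕ.m⊔n≤o⇒n≤o k l k⊔l≤i)) ⟩
    (seq z i ℚ.+ δ) ℚ.+ δ              ≡⟨ ℚ.+-assoc (seq z i) δ δ ⟩
    seq z i ℚ.+ (δ ℚ.+ δ)              ≡⟨ cong (seq z i ℚ.+_) (half+half ε) ⟩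
    seq z i ℚ.+ ε                      ∎
    where
    open ℚ.≤-Reasoning
    δ = ½ ℚ.* ε
    k = proj₁ (h δ {{half-positive ε}})
    p = proj₂ (h δ {{half-positive ε}})
    l = proj₁ (g δ {{half-positive ε}})
    q = proj₂ (g δ {{half-positive ε}})

+-mono-≤ : ∀ {w x y z} → w ≤ x → y ≤ z → w + y ≤ x + z
+-mono-≤ {w} {x} {y} {z} (mk≤ h) (mk≤ g) = mk≤ bound
  where
  bound : ∀ ε → .{{Positive ε}} →
          ∃[ k ] ∀ i → k ≤ℕ i → seq w i ℚ.+ seq y i ℚ.≤ (seq x i ℚ.+ seq z i) ℚ.+ ε
  bound ε = k ℕ.⊔ l , λ i k⊔l≤i → begin
    seq w i ℚ.+ seq y i
      ≤⟨ ℚ.+-mono-≤ (p i (ℕ.m⊔n≤o⇒m≤o k l k⊔l≤i)) (q i (ℕ.m⊔n≤o⇒n≤o k l k⊔l≤i)) ⟩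
    (seq x i ℚ.+ δ) ℚ.+ (seq z i ℚ.+ δ)
      ≡⟨ [p+q]+[ε+δ] (seq x i) (seq z i) δ δ ⟩
    (seq x i ℚ.+ seq z i) ℚ.+ (δ ℚ.+ δ)
      ≡⟨ cong ((seq x i ℚ.+ seq z i) ℚ.+_) (half+half ε) ⟩
    (seq x i ℚ.+ seq z i) ℚ.+ ε
      ∎
    where
    open ℚ.≤-Reasoning
    δ = ½ ℚ.* ε
    k = proj₁ (h δ {{half-positive ε}})
    p = proj₂ (h δ {{half-positive ε}})
    l = proj₁ (g δ {{half-positive ε}})
    q = proj₂ (g δ {{half-positive ε}})

termwise : ∀ {x y} → (∀ i → seq x i ≡ seq y i) → x ≈ y
termwise {x} {y} eq = mk≈ λ ε → 0 , λ i _ →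
  ℚ.≤-trans (ℚ.≤-reflexive (cong ℚ.∣_∣ (trans (cong (ℚ._- seq y i) (eq i)) (ℚ.+-inverseʳ (seq y i)))))
    (ℚ.<⇒≤ (ℚ.positive⁻¹ ε))

≈-refl : ∀ {x} → x ≈ x
≈-refl = termwise λ _ → refl

≈-sym : ∀ {x y} → x ≈ y → y ≈ x
≈-sym {x} {y} (mk≈ h) = mk≈ λ ε → let k , g = h ε in
  k , λ i k≤i → subst (ℚ._≤ ε) (∣p-q∣≡∣q-p∣ (seq x i) (seq y i)) (g i k≤i)

-- Reduced to antisymmetry, so that the halving of the tolerance is left to `≤-trans`; `+-cong` is
-- derived from `+-mono-≤` in the same way.
≈-trans : ∀ {x y z} → x ≈ y → y ≈ z → x ≈ z
≈-trans p q = ≤-antisym (≤-trans (≤-reflexive p) (≤-reflexive q))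
                        (≤-trans (≤-reflexive (≈-sym q)) (≤-reflexive (≈-sym p)))

≈-reflexive : ∀ {x y} → x ≡ y → x ≈ y
≈-reflexive refl = ≈-refl

+-cong : ∀ {w x y z} → w ≈ x → y ≈ z → w + y ≈ x + z
+-cong p q = ≤-antisym (+-mono-≤ (≤-reflexive p) (≤-reflexive q))
                       (+-mono-≤ (≤-reflexive (≈-sym p)) (≤-reflexive (≈-sym q)))

-‿cong : ∀ {x y} → x ≈ y → - x ≈ - y
-‿cong {x} {y} (mk≈ h) = mk≈ λ ε → let k , g = h ε in
  k , λ i k≤i → subst (ℚ._≤ ε)
    (trans (∣p-q∣≡∣q-p∣ (seq x i) (seq y i))
      (cong ℚ.∣_∣ (q-p≡-p--q (seq x i) (seq y i)))) (g i k≤i)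

-- From some index k on, z stays within 1 of `seq z k`, hence is bounded by the constant `B`.
-- Closeness of x and y up to ε / B then suffices.
*-congʳ : ∀ {x y} z → x ≈ y → x * z ≈ y * z
*-congʳ {x} {y} z (mk≈ h) = mk≈ bound
  where
  k = proj₁ (cauchy z 1ℚ)
  settled = proj₂ (cauchy z 1ℚ)
  B = ℚ.∣ seq z k ∣ ℚ.+ 1ℚ

  B>0 : Positive B
  B>0 = ℚ.positive (ℚ.+-mono-≤-< (ℚ.0≤∣p∣ (seq z k)) (ℚ.positive⁻¹ 1ℚ))

  instance
    B≢0 : ℚ.NonZero B
    B≢0 = ℚ.pos⇒nonZero B {{B>0}}

  ∣z∣≤B : ∀ i → k ≤ℕ i → ℚ.∣ seq z i ∣ ℚ.≤ B
  ∣z∣≤B i k≤i = begin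
    ℚ.∣ seq z i ∣
      ≡⟨ cong ℚ.∣_∣ (p≡q+[p-q] (seq z i) (seq z k)) ⟩
    ℚ.∣ seq z k ℚ.+ (seq z i ℚ.- seq z k) ∣
      ≤⟨ ℚ.∣p+q∣≤∣p∣+∣q∣ (seq z k) (seq z i ℚ.- seq z k) ⟩
    ℚ.∣ seq z k ∣ ℚ.+ ℚ.∣ seq z i ℚ.- seq z k ∣
      ≤⟨ ℚ.+-monoʳ-≤ ℚ.∣ seq z k ∣ (settled i k k≤i ℕ.≤-refl) ⟩
    B ∎
    where open ℚ.≤-Reasoning

  bound : ∀ ε → .{{Positive ε}} →
          ∃[ k ] ∀ i → k ≤ℕ i → ℚ.∣ seq x i ℚ.* seq z i ℚ.- seq y i ℚ.* seq z i ∣ ℚ.≤ ε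
  bound ε = k ℕ.⊔ l , λ i k⊔l≤i → begin
    ℚ.∣ seq x i ℚ.* seq z i ℚ.- seq y i ℚ.* seq z i ∣
      ≡⟨ cong ℚ.∣_∣ (pr-qr≡r[p-q] (seq x i) (seq y i) (seq z i)) ⟩
    ℚ.∣ seq z i ℚ.* (seq x i ℚ.- seq y i) ∣
      ≡⟨ ℚ.∣p*q∣≡∣p∣*∣q∣ (seq z i) (seq x i ℚ.- seq y i) ⟩
    ℚ.∣ seq z i ∣ ℚ.* ℚ.∣ seq x i ℚ.- seq y i ∣
      ≤⟨ ℚ.*-monoʳ-≤-nonNeg ℚ.∣ seq x i ℚ.- seq y i ∣ {{ℚ.∣-∣-nonNeg (seq x i ℚ.- seq y i)}}
           (∣z∣≤B i (ℕ.m⊔n≤o⇒m≤o k l k⊔l≤i)) ⟩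
    B ℚ.* ℚ.∣ seq x i ℚ.- seq y i ∣
      ≤⟨ ℚ.*-monoˡ-≤-nonNeg B {{ℚ.pos⇒nonNeg B {{B>0}}}} (g i (ℕ.m⊔n≤o⇒n≤o k l k⊔l≤i)) ⟩
    B ℚ.* (ℚ.1/ B ℚ.* ε)
      ≡⟨ ℚ.*-assoc B (ℚ.1/ B) ε ⟨
    B ℚ.* ℚ.1/ B ℚ.* ε
      ≡⟨ cong (ℚ._* ε) (ℚ.*-inverseʳ B) ⟩
    1ℚ ℚ.* ε
      ≡⟨ ℚ.*-identityˡ ε ⟩
    ε ∎
    where
    open ℚ.≤-Reasoning
    δ>0 : Positive (ℚ.1/ B ℚ.* ε)
    δ>0 = ℚ.pos*pos⇒pos (ℚ.1/ B) {{ℚ.1/pos⇒pos B {{B>0}}}} ε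
    l = proj₁ (h (ℚ.1/ B ℚ.* ε) {{δ>0}})
    g = proj₂ (h (ℚ.1/ B ℚ.* ε) {{δ>0}})

-- The commutative ring of real numbers and its solver.

constant : ℚ → ℝ
constant p = mkℝ (λ _ → p) λ ε → 0 , λ _ _ _ _ → ℚ.≤-trans
  (ℚ.≤-reflexive (cong ℚ.∣_∣ (ℚ.+-inverseʳ p))) (ℚ.<⇒≤ (ℚ.positive⁻¹ ε))

1ℝ : ℝ
1ℝ = constant 1ℚ

≈-isEquivalence : IsEquivalence _≈_
≈-isEquivalence = record { refl = ≈-refl ; sym = ≈-sym ; trans = ≈-trans }

+-*-isCommutativeRing : IsCommutativeRing _≈_ _+_ _*_ -_ 0ℝ 1ℝ
+-*-isCommutativeRing = record
  { isRing = record
    { +-isAbelianGroup = record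
      { isGroup = record
        { isMonoid = record
          { isSemigroup = record
            { isMagma = record { isEquivalence = ≈-isEquivalence ; ∙-cong = +-cong }
            ; assoc = λ x y z → termwise λ i → ℚ.+-assoc (seq x i) (seq y i) (seq z i)
            }
          ; identity = (λ x → termwise λ i → ℚ.+-identityˡ (seq x i))
                     , (λ x → termwise λ i → ℚ.+-identityʳ (seq x i))
          }
        ; inverse = (λ x → termwise λ i → ℚ.+-inverseˡ (seq x i))
                  , (λ x → termwise λ i → ℚ.+-inverseʳ (seq x i))
        ; ⁻¹-cong = -‿cong
        }
      ; comm = λ x y → termwise λ i → ℚ.+-comm (seq x i) (seq y i)
      }
    ; *-cong = λ {x} {y} {u} {v} p q → ≈-trans (*-congʳ u p)
        (≈-trans (*-comm y u) (≈-trans (*-congʳ y q) (*-comm v y)))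
    ; *-assoc = λ x y z → termwise λ i → ℚ.*-assoc (seq x i) (seq y i) (seq z i)
    ; *-identity = (λ x → termwise λ i → ℚ.*-identityˡ (seq x i))
                 , (λ x → termwise λ i → ℚ.*-identityʳ (seq x i))
    ; distrib = (λ x y z → termwise λ i → ℚ.*-distribˡ-+ (seq x i) (seq y i) (seq z i))
              , (λ x y z → termwise λ i → ℚ.*-distribʳ-+ (seq x i) (seq y i) (seq z i))
    }
  ; *-comm = *-comm
  }
  where
  *-comm : ∀ x y → x * y ≈ y * x
  *-comm x y = termwise λ i → ℚ.*-comm (seq x i) (seq y i)

+-*-commutativeRing : CommutativeRing 0ℓ 0ℓ
+-*-commutativeRing = record { isCommutativeRing = +-*-isCommutativeRing }

-- fromℚ 0ℚ is 0ℝ definitionally, so that 0ℝ can be written con 0ℚ in the solver.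
fromℚ : ℚ → ℝ
fromℚ p = if does (p ℚ.≟ 0ℚ) then 0ℝ else constant p

fromℚ≈constant : ∀ p → fromℚ p ≈ constant p
fromℚ≈constant p with p ℚ.≟ 0ℚ
... | yes p≡0 = termwise λ _ → sym p≡0
... | no _    = ≈-refl

fromℚ-cong : ∀ {p x} → constant p ≈ x → fromℚ p ≈ x
fromℚ-cong {p} = ≈-trans (fromℚ≈constant p)

fromℚ-homomorphism : CommutativeRing.rawRing ℚ.+-*-commutativeRing
  -Raw-AlmostCommutative⟶ fromCommutativeRing +-*-commutativeRing
fromℚ-homomorphism = record
  { ⟦_⟧    = fromℚ
  ; +-homo = λ p q → fromℚ-cong (≈-trans (termwise λ _ → refl)
      (≈-sym (+-cong (fromℚ≈constant p) (fromℚ≈constant q))))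
  ; *-homo = λ p q → fromℚ-cong (≈-trans (termwise λ _ → refl)
      (≈-sym (*-cong (fromℚ≈constant p) (fromℚ≈constant q))))
  ; -‿homo = λ p → fromℚ-cong (≈-trans (termwise λ _ → refl) (-‿cong (≈-sym (fromℚ≈constant p))))
  ; 0-homo = ≈-refl
  ; 1-homo = ≈-refl
  }
  where open CommutativeRing +-*-commutativeRing using (*-cong)

-- The solver takes rational coefficients because equality of rationals is decidable, so that
-- cancelling coefficients are recognized.
fromℚ-≟ : ∀ p q → Maybe (fromℚ p ≈ fromℚ q)
fromℚ-≟ p q = Maybe.map (λ p≡q → ≈-reflexive (cong fromℚ p≡q)) (dec⇒maybe (p ℚ.≟ q))

module ℝ-Solver = RingSolver (CommutativeRing.rawRing ℚ.+-*-commutativeRing)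
  (fromCommutativeRing +-*-commutativeRing) fromℚ-homomorphism fromℚ-≟
open ℝ-Solver using (solve; con; _:+_; _:-_; :-_; _:*_; _:=_)
open CommutativeRing +-*-commutativeRing
  using ( +-comm; +-identityˡ; +-identityʳ; -‿inverseʳ; *-congˡ; *-identityʳ
        ; zeroˡ; zeroʳ; distribʳ; setoid; +-commutativeMonoid )
open Summation +-commutativeMonoid using (sum; sum-cong-≋; ∑-distrib-+)
open CommutativeSemigroupProperties
  (CommutativeMonoid.commutativeSemigroup +-commutativeMonoid) using (interchange)

≤-refl : ∀ {x} → x ≤ x
≤-refl = ≤-reflexive ≈-refl

≤-respˡ-≈ : ∀ {x y z} → x ≈ y → x ≤ z → y ≤ z
≤-respˡ-≈ x≈y = ≤-trans (≤-reflexive (≈-sym x≈y))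

≤-respʳ-≈ : ∀ {x y z} → y ≈ z → x ≤ y → x ≤ z
≤-respʳ-≈ y≈z x≤y = ≤-trans x≤y (≤-reflexive y≈z)

-- Only the difference of the two sides matters. Most inequalities below are reduced in this way to
-- a known one and a ring identity left to the solver; `≈-via` does the same for equations.
≤-via : ∀ {a b c d} → c ≤ d → b - a ≈ d - c → a ≤ b
≤-via {a} {b} {c} {d} c≤d eq =
  ≤-respˡ-≈ (solve 2 (λ a c → (a :- c) :+ c := a) ≈-refl a c)
    (≤-respʳ-≈ (≈-trans (solve 3 (λ a c d → (a :- c) :+ d := (d :- c) :+ a) ≈-refl a c d)
                 (≈-trans (+-cong (≈-sym eq) ≈-refl) (solve 2 (λ a b → (b :- a) :+ a := b) ≈-refl a b)))
      (+-mono-≤ ≤-refl c≤d))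

≈-via : ∀ {a b c d} → c ≈ d → a - b ≈ c - d → a ≈ b
≈-via {a} {b} {c} {d} c≈d eq = ≤-antisym
  (≤-via (≤-reflexive c≈d) (begin
    b - a      ≈⟨ y-x≈-[x-y] a b ⟩
    - (a - b)  ≈⟨ -‿cong eq ⟩
    - (c - d)  ≈⟨ y-x≈-[x-y] c d ⟨
    d - c      ∎))
  (≤-via (≤-reflexive (≈-sym c≈d)) eq)
  where
  open ≈-Reasoning setoid
  y-x≈-[x-y] : ∀ x y → y - x ≈ - (x - y)
  y-x≈-[x-y] = solve 2 (λ x y → y :- x := :- (x :- y)) ≈-refl

x-y≈0⇔x≈y : ∀ {z u v} → z ≈ u - v → z ≈ 0ℝ ⇔ u ≈ v
x-y≈0⇔x≈y {z} {u} {v} z≈u-v = mk⇔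
  (λ z≈0 → ≈-via (≈-trans (≈-sym z≈u-v) z≈0) (solve 2 (λ u v → u :- v := (u :- v) :- con 0ℚ) ≈-refl u v))
  (λ u≈v → ≈-trans z≈u-v (≈-trans (+-cong u≈v ≈-refl) (-‿inverseʳ v)))

-- Sums

∑Subset-cong : ∀ {n} {f g : Subset n → ℝ} → (∀ A → f A ≈ g A) → ∑Subset f ≈ ∑Subset g
∑Subset-cong {zero}  h = h []
∑Subset-cong {suc n} h = +-cong (∑Subset-cong (h ∘ (outside ∷_))) (∑Subset-cong (h ∘ (inside ∷_)))

∑Subset-distrib-+ : ∀ {n} (f g : Subset n → ℝ) →
  ∑Subset (λ A → f A + g A) ≈ ∑Subset f + ∑Subset g
∑Subset-distrib-+ {zero}  f g = ≈-refl
∑Subset-distrib-+ {suc n} f g = ≈-trans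
  (+-cong (∑Subset-distrib-+ (f ∘ (outside ∷_)) (g ∘ (outside ∷_)))
          (∑Subset-distrib-+ (f ∘ (inside ∷_)) (g ∘ (inside ∷_))))
  (interchange _ _ _ _)

∑Subset-distribʳ-* : ∀ {n} (f : Subset n → ℝ) c → ∑Subset (λ A → f A * c) ≈ ∑Subset f * c
∑Subset-distribʳ-* {zero}  f c = ≈-refl
∑Subset-distribʳ-* {suc n} f c = ≈-trans
  (+-cong (∑Subset-distribʳ-* (f ∘ (outside ∷_)) c) (∑Subset-distribʳ-* (f ∘ (inside ∷_)) c))
  (≈-sym (distribʳ c _ _))

∑Subset-zero : ∀ {n} {f : Subset n → ℝ} → (∀ A → f A ≈ 0ℝ) → ∑Subset f ≈ 0ℝ
∑Subset-zero {zero}  h = h []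
∑Subset-zero {suc n} h = ≈-trans
  (+-cong (∑Subset-zero (h ∘ (outside ∷_))) (∑Subset-zero (h ∘ (inside ∷_)))) (+-identityˡ 0ℝ)

∑Subset-single : ∀ {n} (A : Subset n) {f : Subset n → ℝ} →
  (∀ B → B ≢ A → f B ≈ 0ℝ) → ∑Subset f ≈ f A
∑Subset-single []            h = ≈-refl
∑Subset-single (outside ∷ A) h = ≈-trans
  (+-cong (∑Subset-single A (λ B B≢A → h (outside ∷ B) λ { refl → B≢A refl }))
          (∑Subset-zero (λ B → h (inside ∷ B) λ ())))
  (+-identityʳ _)
∑Subset-single (inside ∷ A)  h = ≈-trans
  (+-cong (∑Subset-zero (λ B → h (outside ∷ B) λ ()))
          (∑Subset-single A (λ B B≢A → h (inside ∷ B) λ { refl → B≢A refl })))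
  (+-identityˡ _)

ifTrue-yes : ∀ {P : Set} (P? : Dec P) (f : .P → ℝ) (p : P) → ifTrue P? f ≡ f p
ifTrue-yes (yes _) f p = refl
ifTrue-yes (no ¬p) f p = ⊥-elim (¬p p)

ifTrue-no : ∀ {P : Set} (P? : Dec P) (f : .P → ℝ) → ¬ P → ifTrue P? f ≡ 0ℝ
ifTrue-no (yes p) f ¬p = ⊥-elim (¬p p)
ifTrue-no (no _)  f ¬p = refl

ifTrue-cong : ∀ {P : Set} (P? : Dec P) {f g : .P → ℝ} →
  (∀ .p → f p ≈ g p) → ifTrue P? f ≈ ifTrue P? g
ifTrue-cong (yes p) h = h p
ifTrue-cong (no _)  h = ≈-refl

ifTrue-distrib-+ : ∀ {P : Set} (P? : Dec P) (f g : .P → ℝ) →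
  ifTrue P? (λ p → f p + g p) ≈ ifTrue P? f + ifTrue P? g
ifTrue-distrib-+ (yes p) f g = ≈-refl
ifTrue-distrib-+ (no _)  f g = ≈-sym (+-identityˡ 0ℝ)

ifTrue-distribʳ-* : ∀ {P : Set} (P? : Dec P) (f : .P → ℝ) c →
  ifTrue P? (λ p → f p * c) ≈ ifTrue P? f * c
ifTrue-distribʳ-* (yes p) f c = ≈-refl
ifTrue-distribʳ-* (no _)  f c = ≈-sym (zeroˡ c)

module _ {n} (N : Subset n) where

  ∑𝒫-cong : {f g : SetFunction N} → (∀ A → f A ≈ g A) → ∑𝒫 N f ≈ ∑𝒫 N g
  ∑𝒫-cong h = ∑Subset-cong λ A → ifTrue-cong (A ⊆? N) λ p → h (A , [ p ])

  ∑𝒫-distrib-+ : (f g : SetFunction N) → ∑𝒫 N (λ A → f A + g A) ≈ ∑𝒫 N f + ∑𝒫 N g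
  ∑𝒫-distrib-+ f g = ≈-trans
    (∑Subset-cong λ A → ifTrue-distrib-+ (A ⊆? N) (λ p → f (A , [ p ])) (λ p → g (A , [ p ])))
    (∑Subset-distrib-+ (λ A → ifTrue (A ⊆? N) (λ p → f (A , [ p ])))
                       (λ A → ifTrue (A ⊆? N) (λ p → g (A , [ p ]))))

  ∑𝒫-distribʳ-* : (f : SetFunction N) → ∀ c → ∑𝒫 N (λ A → f A * c) ≈ ∑𝒫 N f * c
  ∑𝒫-distribʳ-* f c = ≈-trans
    (∑Subset-cong λ A → ifTrue-distribʳ-* (A ⊆? N) (λ p → f (A , [ p ])) c)
    (∑Subset-distribʳ-* (λ A → ifTrue (A ⊆? N) (λ p → f (A , [ p ]))) c)

  ∑𝒫-single : (A : 𝒫 N) {f : SetFunction N} →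
    (∀ B → value B ≢ value A → f B ≈ 0ℝ) → ∑𝒫 N f ≈ f A
  ∑𝒫-single A@(A′ , [ A⊆N ]) {f} h = ≈-trans (∑Subset-single A′ vanishes) at-A
    where
    vanishes : ∀ B → B ≢ A′ → ifTrue (B ⊆? N) (λ p → f (B , [ p ])) ≈ 0ℝ
    vanishes B B≢A with B ⊆? N
    ... | yes p = h (B , [ p ]) B≢A
    ... | no _  = ≈-refl
    at-A : ifTrue (A′ ⊆? N) (λ p → f (A′ , [ p ])) ≈ f A
    at-A with A′ ⊆? N
    ... | yes _ = ≈-refl
    ... | no A⊈N = ⊥-elim-irr (A⊈N A⊆N)

-- Linear functionals

-- Linearity is recorded by a representing vector, because a face has to be given by the vector that
-- cuts it out. Additivity is recovered from it in `linear-+`.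
record Linear {n} {N : Subset n} (φ : SetFunction N → ℝ) : Set where
  constructor linear
  field
    vector     : SetFunction N
    represents : ∀ m → φ m ≈ ⟨ m , vector ⟩
open Linear

private
  _≟_ : ∀ {n} → DecidableEquality (Subset n)
  _≟_ = ≡-dec Bool._≟_

module _ {n} {N : Subset n} where

  evaluation-linear : (A : 𝒫 N) → Linear (λ m → m A)
  evaluation-linear A = linear δ λ m → ≈-sym (begin
    ∑𝒫 N (λ B → m B * δ B)  ≈⟨ ∑𝒫-single N A (λ B B≢A → ≈-trans
                                 (*-congˡ (≈-reflexive (ifTrue-no (value B ≟ value A) _ B≢A))) (zeroʳ (m B))) ⟩
    m A * δ A               ≈⟨ *-congˡ (≈-reflexive (ifTrue-yes (value A ≟ value A) _ refl)) ⟩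
    m A * 1ℝ                ≈⟨ *-identityʳ (m A) ⟩
    m A                     ∎)
    where
    open ≈-Reasoning setoid
    δ : SetFunction N
    δ B = ifTrue (value B ≟ value A) (λ _ → 1ℝ)

  zero-linear : Linear {N = N} (λ _ → 0ℝ)
  zero-linear = linear (λ _ → 0ℝ) λ m → ≈-sym (≈-trans (∑𝒫-distribʳ-* N m 0ℝ) (zeroʳ _))

  +-linear : ∀ {φ ψ : SetFunction N → ℝ} → Linear φ → Linear ψ → Linear (λ m → φ m + ψ m)
  +-linear φ-lin ψ-lin = linear (λ A → vector φ-lin A + vector ψ-lin A) λ m → ≈-trans
    (+-cong (represents φ-lin m) (represents ψ-lin m))
    (≈-trans (≈-sym (∑𝒫-distrib-+ N (λ A → m A * vector φ-lin A) (λ A → m A * vector ψ-lin A)))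
      (∑𝒫-cong N λ A → solve 3 (λ a b c → a :* b :+ a :* c := a :* (b :+ c)) ≈-refl
                         (m A) (vector φ-lin A) (vector ψ-lin A)))

  *-linear : ∀ {φ : SetFunction N → ℝ} → Linear φ → ∀ c → Linear (λ m → φ m * c)
  *-linear φ-lin c = linear (λ A → vector φ-lin A * c) λ m → ≈-trans
    (*-congʳ c (represents φ-lin m))
    (≈-trans (≈-sym (∑𝒫-distribʳ-* N (λ A → m A * vector φ-lin A) c))
      (∑𝒫-cong N λ A → solve 3 (λ a b c → a :* b :* c := a :* (b :* c)) ≈-refl
                         (m A) (vector φ-lin A) c))

  linear-resp : ∀ {φ ψ : SetFunction N → ℝ} → (∀ m → φ m ≈ ψ m) → Linear φ → Linear ψ
  linear-resp φ≈ψ φ-lin = linear (vector φ-lin) λ m → ≈-trans (≈-sym (φ≈ψ m)) (represents φ-lin m)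

  neg-linear : ∀ {φ : SetFunction N → ℝ} → Linear φ → Linear (λ m → - φ m)
  neg-linear {φ} φ-lin = linear-resp
    (λ m → solve 1 (λ a → a :* con (ℚ.- ℚ.1ℚ) := :- a) ≈-refl (φ m))
    (*-linear φ-lin (constant (ℚ.- ℚ.1ℚ)))

  ifTrue-linear : ∀ {P : Set} (P? : Dec P) {φ : .P → SetFunction N → ℝ} →
    (∀ .p → Linear (φ p)) → Linear (λ m → ifTrue P? (λ p → φ p m))
  ifTrue-linear (yes p) h = h p
  ifTrue-linear (no _)  h = zero-linear

  ∑Subset-linear : ∀ {k} {φ : Subset k → SetFunction N → ℝ} →
    (∀ A → Linear (φ A)) → Linear (λ m → ∑Subset (λ A → φ A m))
  ∑Subset-linear {zero}  h = h []
  ∑Subset-linear {suc k} h =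
    +-linear (∑Subset-linear (h ∘ (outside ∷_))) (∑Subset-linear (h ∘ (inside ∷_)))

  foldr-linear : ∀ {k} {φ : Fin k → SetFunction N → ℝ} →
    (∀ i → Linear (φ i)) → Linear (λ m → foldr _+_ 0ℝ (λ i → φ i m))
  foldr-linear {zero}  h = zero-linear
  foldr-linear {suc k} h = +-linear (h zero) (foldr-linear (h ∘ suc))

  ∑∈-linear : ∀ {k} (T : Subset k) {φ : (i : Fin k) → .(i ∈ T) → SetFunction N → ℝ} →
    (∀ i .(p : i ∈ T) → Linear (φ i p)) → Linear (λ m → ∑∈ T (λ i p → φ i p m))
  ∑∈-linear T h = foldr-linear λ i → ifTrue-linear (i ∈? T) (h i)

  ⟨⟩-linear : (v : SetFunction N) → Linear (λ m → ⟨ m , v ⟩)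
  ⟨⟩-linear v = linear v λ _ → ≈-refl

  linear-cong : ∀ {φ : SetFunction N → ℝ} → Linear φ →
    ∀ {m m′ : SetFunction N} → (∀ A → m A ≈ m′ A) → φ m ≈ φ m′
  linear-cong φ-lin {m} {m′} m≈m′ = ≈-trans (represents φ-lin m)
    (≈-trans (∑𝒫-cong N λ A → *-congʳ (vector φ-lin A) (m≈m′ A)) (≈-sym (represents φ-lin m′)))

  linear-+ : ∀ {φ : SetFunction N → ℝ} → Linear φ →
    ∀ m m′ → φ (λ A → m A + m′ A) ≈ φ m + φ m′
  linear-+ {φ} φ-lin m m′ = begin
    φ (λ A → m A + m′ A)
      ≈⟨ represents φ-lin _ ⟩
    ∑𝒫 N (λ A → (m A + m′ A) * v A)
      ≈⟨ ∑𝒫-cong N (λ A → distribʳ (v A) (m A) (m′ A)) ⟩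
    ∑𝒫 N (λ A → m A * v A + m′ A * v A)
      ≈⟨ ∑𝒫-distrib-+ N (λ A → m A * v A) (λ A → m′ A * v A) ⟩
    ⟨ m , v ⟩ + ⟨ m′ , v ⟩
      ≈⟨ +-cong (represents φ-lin m) (represents φ-lin m′) ⟨
    φ m + φ m′ ∎
    where
    open ≈-Reasoning setoid
    v = vector φ-lin

  linear-0 : ∀ {φ : SetFunction N → ℝ} → Linear φ → φ (λ _ → 0ℝ) ≈ 0ℝ
  linear-0 {φ} φ-lin = ≈-via
    (≈-sym (≈-trans (linear-cong φ-lin (λ _ → ≈-sym (+-identityˡ 0ℝ)))
                    (linear-+ φ-lin (λ _ → 0ℝ) (λ _ → 0ℝ))))
    (solve 1 (λ a → a :- con 0ℚ := (a :+ a) :- a) ≈-refl (φ (λ _ → 0ℝ)))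

  linear-neg : ∀ {φ : SetFunction N → ℝ} → Linear φ → ∀ m → φ (λ A → - m A) ≈ - φ m
  linear-neg {φ} φ-lin m = ≈-via
    (≈-trans (≈-sym (linear-+ φ-lin m (λ A → - m A)))
      (≈-trans (linear-cong φ-lin (λ A → -‿inverseʳ (m A))) (linear-0 φ-lin)))
    (solve 2 (λ a b → b :- (:- a) := (a :+ b) :- con 0ℚ) ≈-refl (φ m) (φ (λ A → - m A)))

LinearMap : ∀ {n} {M N : Subset n} → (SetFunction M → SetFunction N) → Set
LinearMap T = ∀ A → Linear (λ m → T m A)

-- Expanding φ along its vector writes `φ (T m)` as a finite sum of multiples of the functionals
-- `T m A`. The resulting vector is the transpose of `T` applied to the vector of φ.
∘-linear : ∀ {n} {M N : Subset n} {φ : SetFunction N → ℝ} {T : SetFunction M → SetFunction N} →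
  Linear φ → LinearMap T → Linear (φ ∘ T)
∘-linear {N = N} {φ} {T} φ-lin T-lin = linear-resp (λ m → ≈-sym (represents φ-lin (T m)))
  (∑Subset-linear λ A → ifTrue-linear (A ⊆? N)
    λ p → *-linear (T-lin (A , [ p ])) (vector φ-lin (A , [ p ])))

-- Faces

module _ {n} {N : Subset n} where

  infix 4 _≋_
  _≋_ : SetFunction N → SetFunction N → Set
  m ≋ m′ = ∀ A → m A ≈ m′ A

  𝒦-resp-≋ : ∀ {m m′} → m ≋ m′ → 𝒦 N m → 𝒦 N m′
  𝒦-resp-≋ m≋m′ m∈𝒦 A B = ≤-respˡ-≈ (+-cong (m≋m′ A) (m≋m′ B))
    (≤-respʳ-≈ (+-cong (m≋m′ (A ∪ B)) (m≋m′ (A ∩ B))) (m∈𝒦 A B))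

  Modular-resp-≋ : ∀ {m m′} → m ≋ m′ → Modular N m → Modular N m′
  Modular-resp-≋ m≋m′ (p , q) = 𝒦-resp-≋ m≋m′ p , 𝒦-resp-≋ (λ A → -‿cong (m≋m′ A)) q

  0∈𝒦 : 𝒦 N (λ _ → 0ℝ)
  0∈𝒦 A B = ≤-refl

  𝒦-+ : ∀ {m m′} → 𝒦 N m → 𝒦 N m′ → 𝒦 N (λ A → m A + m′ A)
  𝒦-+ {m} {m′} p q A B = ≤-via (+-mono-≤ (p A B) (q A B))
    (solve 8 (λ a b c d e f g h → (a :+ b :+ (c :+ d)) :- (e :+ f :+ (g :+ h))
                               := ((a :+ c) :+ (b :+ d)) :- ((e :+ g) :+ (f :+ h)))
       ≈-refl (m (A ∪ B)) (m′ (A ∪ B)) (m (A ∩ B)) (m′ (A ∩ B)) (m A) (m′ A) (m B) (m′ B))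

  modular-≈ : ∀ {m} → Modular N m → ∀ A B → m A + m B ≈ m (A ∪ B) + m (A ∩ B)
  modular-≈ {m} (p , q) A B = ≤-antisym (p A B)
    (≤-via (q A B) (solve 4 (λ a b c d → (a :+ b) :- (c :+ d) := (:- c :+ :- d) :- (:- a :+ :- b))
      ≈-refl (m A) (m B) (m (A ∪ B)) (m (A ∩ B))))

  ≈⇒Modular : ∀ {m} → (∀ A B → m A + m B ≈ m (A ∪ B) + m (A ∩ B)) → Modular N m
  ≈⇒Modular {m} h = (λ A B → ≤-reflexive (h A B)) , λ A B → ≤-via (≤-reflexive (≈-sym (h A B)))
    (solve 4 (λ a b c d → (:- c :+ :- d) :- (:- a :+ :- b) := (a :+ b) :- (c :+ d))
      ≈-refl (m A) (m B) (m (A ∪ B)) (m (A ∩ B)))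

  module _ (F : Face (𝒦 N)) where
    open Face F using (v; k; valid)

    carrier-resp-≋ : ∀ {m m′} → m ≋ m′ → carrier F m → carrier F m′
    carrier-resp-≋ m≋m′ (m∈𝒦 , k≈) =
      𝒦-resp-≋ m≋m′ m∈𝒦 , ≈-trans k≈ (linear-cong (⟨⟩-linear v) m≋m′)

    -- If q lies on the face, then q + q lies in the cone, so k ≤ 2k and 0 ≤ k; validity at the zero
    -- function gives k ≤ 0.
    0∈carrier : NonEmpty F → carrier F (λ _ → 0ℝ)
    0∈carrier (q , q∈𝒦 , k≈) = 0∈𝒦 , ≤-antisym (valid _ 0∈𝒦)
      (≤-respˡ-≈ (≈-sym (linear-0 (⟨⟩-linear v)))
        (≤-via (≤-respʳ-≈ (≈-trans (linear-+ (⟨⟩-linear v) q q) (+-cong (≈-sym k≈) (≈-sym k≈)))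
                          (valid _ (𝒦-+ q∈𝒦 q∈𝒦)))
          (solve 1 (λ k → k :- con 0ℚ := (k :+ k) :- k) ≈-refl k)))

    -- Both q + μ and q - μ lie in the cone, so validity bounds the functional at μ by 0 from below
    -- and from above.
    carrier-+-modular : ∀ {q μ} → carrier F q → Modular N μ → carrier F (λ A → q A + μ A)
    carrier-+-modular {q} {μ} (q∈𝒦 , k≈) (μ∈𝒦 , -μ∈𝒦) = 𝒦-+ q∈𝒦 μ∈𝒦 , ≤-antisym
      (valid _ (𝒦-+ q∈𝒦 μ∈𝒦))
      (≤-via (≤-respʳ-≈ (≈-trans (linear-+ (⟨⟩-linear v) q (λ A → - μ A))
                          (+-cong (≈-sym k≈) (linear-neg (⟨⟩-linear v) μ))) (valid _ (𝒦-+ q∈𝒦 -μ∈𝒦)))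
        (≈-trans (+-cong ≈-refl (-‿cong (≈-trans (linear-+ (⟨⟩-linear v) q μ) (+-cong (≈-sym k≈) ≈-refl))))
          (solve 2 (λ k a → k :- (k :+ a) := (k :- a) :- k) ≈-refl k ⟨ μ , v ⟩)))

    Modular⊆carrier : NonEmpty F → Modular N Pred.⊆ carrier F
    Modular⊆carrier ne μ∈Mod =
      carrier-resp-≋ (λ A → +-identityˡ _) (carrier-+-modular (0∈carrier ne) μ∈Mod)

-- Transport of faces and of extreme functions along a linear embedding of cones.

record FaceEmbedding {n} (M N : Subset n) : Set where
  field
    T         : SetFunction M → SetFunction N
    R         : SetFunction N → SetFunction M
    Φ         : SetFunction N → ℝ
    T-linear  : LinearMap T
    R-linear  : LinearMap R
    Φ-linear  : Linear Φ
    T-𝒦       : ∀ {r} → 𝒦 M r → 𝒦 N (T r)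
    R-𝒦       : ∀ {m} → 𝒦 N m → 𝒦 M (R m)
    R∘T       : ∀ r → R (T r) ≋ r
    -- Together the last three fields say that the face Φ = 0 of `𝒦 N` is the image of `𝒦 M` under
    -- `T`, enlarged by the modular functions.
    Φ-nonNeg  : ∀ {m} → 𝒦 N m → 0ℝ ≤ Φ m
    Φ∘T       : ∀ r → Φ (T r) ≈ 0ℝ
    T∘R       : ∀ {m} → 𝒦 N m → Φ m ≈ 0ℝ → Modular N (λ S → m S - T (R m) S)

module _ {n} {M N : Subset n} (E : FaceEmbedding M N) where
  open FaceEmbedding E

  T-Modular : ∀ {r} → Modular M r → Modular N (T r)
  T-Modular {r} (p , q) = T-𝒦 p , 𝒦-resp-≋ (λ A → linear-neg (T-linear A) r) (T-𝒦 q)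

  R-Modular : ∀ {m} → Modular N m → Modular M (R m)
  R-Modular {m} (p , q) = R-𝒦 p , 𝒦-resp-≋ (λ A → linear-neg (R-linear A) m) (R-𝒦 q)

  -- The functional of G is composed with `T` and the bound is kept; it stays valid because `T`
  -- preserves supermodularity.
  preimage : Face (𝒦 N) → Face (𝒦 M)
  preimage G = record
    { v     = vector G∘T
    ; k     = Face.k G
    ; valid = λ r r∈𝒦 → ≤-respʳ-≈ (represents G∘T r) (Face.valid G (T r) (T-𝒦 r∈𝒦))
    }
    where
    G∘T : Linear (λ r → ⟨ T r , Face.v G ⟩)
    G∘T = ∘-linear (⟨⟩-linear (Face.v G)) T-linear

  ∈preimage⁺ : ∀ G {r} → 𝒦 M r → carrier G (T r) → carrier (preimage G) r
  ∈preimage⁺ G r∈𝒦 (_ , k≈) =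
    r∈𝒦 , ≈-trans k≈ (represents (∘-linear (⟨⟩-linear (Face.v G)) T-linear) _)

  ∈preimage⁻ : ∀ G {r} → carrier (preimage G) r → carrier G (T r)
  ∈preimage⁻ G (r∈𝒦 , k≈) =
    T-𝒦 r∈𝒦 , ≈-trans k≈ (≈-sym (represents (∘-linear (⟨⟩-linear (Face.v G)) T-linear) _))

  -- Composition with `R` alone would put no bound on Φ. Adding Φ, which is nonnegative on the cone,
  -- confines the face to Φ = 0.
  lift : Face (𝒦 M) → Face (𝒦 N)
  lift F = record
    { v     = vector F∘R+Φ
    ; k     = Face.k F
    ; valid = λ m m∈𝒦 → ≤-respʳ-≈ (represents F∘R+Φ m)
        (≤-respˡ-≈ (+-identityʳ _) (+-mono-≤ (Face.valid F (R m) (R-𝒦 m∈𝒦)) (Φ-nonNeg m∈𝒦)))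
    }
    where
    F∘R+Φ : Linear (λ m → ⟨ R m , Face.v F ⟩ + Φ m)
    F∘R+Φ = +-linear (∘-linear (⟨⟩-linear (Face.v F)) R-linear) Φ-linear

  ∈lift⁺ : ∀ F {m} → 𝒦 N m → Face.k F ≈ ⟨ R m , Face.v F ⟩ + Φ m → carrier (lift F) m
  ∈lift⁺ F m∈𝒦 k≈ = m∈𝒦 ,
    ≈-trans k≈ (represents (+-linear (∘-linear (⟨⟩-linear (Face.v F)) R-linear) Φ-linear) _)

  -- The first summand is at least k and Φ is at least 0, so a sum equal to k forces equality in
  -- both.
  ∈lift⁻ : ∀ F {m} → carrier (lift F) m → carrier F (R m) × Φ m ≈ 0ℝ
  ∈lift⁻ F {m} (m∈𝒦 , k≈) = (R-𝒦 m∈𝒦 , k≈⟨Rm,v⟩) , Φm≈0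
    where
    k≈sum : Face.k F ≈ ⟨ R m , Face.v F ⟩ + Φ m
    k≈sum = ≈-trans k≈
      (≈-sym (represents (+-linear (∘-linear (⟨⟩-linear (Face.v F)) R-linear) Φ-linear) _))
    Φm≈0 : Φ m ≈ 0ℝ
    Φm≈0 = ≤-antisym
      (≤-via (≤-respˡ-≈ k≈sum (Face.valid F (R m) (R-𝒦 m∈𝒦)))
        (solve 2 (λ a b → con 0ℚ :- b := a :- (a :+ b)) ≈-refl ⟨ R m , Face.v F ⟩ (Φ m)))
      (Φ-nonNeg m∈𝒦)
    k≈⟨Rm,v⟩ : Face.k F ≈ ⟨ R m , Face.v F ⟩
    k≈⟨Rm,v⟩ = ≈-trans k≈sum (≈-trans (+-cong ≈-refl Φm≈0) (+-identityʳ _))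

  T∈lift : ∀ F {r} → carrier F r → carrier (lift F) (T r)
  T∈lift F {r} (r∈𝒦 , k≈) = ∈lift⁺ F (T-𝒦 r∈𝒦) (≈-trans k≈
    (≈-trans (≈-sym (+-identityʳ _))
      (+-cong (linear-cong (⟨⟩-linear (Face.v F)) (λ A → ≈-sym (R∘T r A))) (≈-sym (Φ∘T r)))))

  T∈lift⁻ : ∀ F {r} → carrier (lift F) (T r) → carrier F r
  T∈lift⁻ F {r} Tr∈ = carrier-resp-≋ F (R∘T r) (proj₁ (∈lift⁻ F Tr∈))

  R-T-≋ : ∀ {m : SetFunction N} → (λ S → T (R m) S + (m S - T (R m) S)) ≋ m
  R-T-≋ {m} S = solve 2 (λ a b → b :+ (a :- b) := a) ≈-refl (m S) (T (R m) S)

  -- On Φ = 0, m is `T (R m)` plus a modular function, and faces absorb modular functions.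
  -- `carrier-TR` goes back by adding the negative of that function.
  carrier-TR⇒ : ∀ G {m} → 𝒦 N m → Φ m ≈ 0ℝ → carrier G (T (R m)) → carrier G m
  carrier-TR⇒ G m∈𝒦 Φm≈0 TRm∈ =
    carrier-resp-≋ G R-T-≋ (carrier-+-modular G TRm∈ (T∘R m∈𝒦 Φm≈0))

  Modular-R⇒ : ∀ {m} → 𝒦 N m → Φ m ≈ 0ℝ → Modular M (R m) → Modular N m
  Modular-R⇒ {m} m∈𝒦 Φm≈0 Rm∈ = Modular-resp-≋ R-T-≋ (≈⇒Modular additive)
    where
    additive : ∀ A B → _
    additive A B = ≈-via (+-cong (modular-≈ (T-Modular Rm∈) A B) (modular-≈ (T∘R m∈𝒦 Φm≈0) A B))
      (solve 8 (λ a b c d e f g h → (a :+ b :+ (c :+ d)) :- (e :+ f :+ (g :+ h))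
                               := ((a :+ c) :+ (b :+ d)) :- ((e :+ g) :+ (f :+ h)))
        ≈-refl (t A) (d A) (t B) (d B) (t (A ∪ B)) (d (A ∪ B)) (t (A ∩ B)) (d (A ∩ B)))
      where
      t d : SetFunction N
      t S = T (R m) S
      d S = m S - T (R m) S

  carrier-TR : ∀ G {m} → Φ m ≈ 0ℝ → carrier G m → carrier G (T (R m))
  carrier-TR G {m} Φm≈0 m∈@(m∈𝒦 , _) = carrier-resp-≋ G
    (λ S → solve 2 (λ a b → a :+ :- (a :- b) := b) ≈-refl (m S) (T (R m) S))
    (carrier-+-modular G m∈ (neg (T∘R m∈𝒦 Φm≈0)))
    where
    neg : ∀ {μ} → Modular N μ → Modular N (λ S → - μ S)
    neg (p , q) = q , 𝒦-resp-≋ (λ S → solve 1 (λ a → a := :- :- a) ≈-refl _) p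

  -- The lift of the smallest face at r is the smallest face at `T r`. Faces of `𝒦 N` are compared
  -- with it through their preimages.
  Extreme-T : ∀ {r} → Extreme M r → Extreme N (T r)
  Extreme-T {r} (r∈𝒦 , F , (r∈F , smallest) , ne , F≢Mod , atom) =
    T-𝒦 r∈𝒦 , F′ , (T∈lift F r∈F , smallest′) , (T r , T∈lift F r∈F) , F′≢Mod , atom′
    where
    F′ = lift F

    smallest′ : ∀ G → carrier G (T r) → carrier F′ Pred.⊆ carrier G
    smallest′ G Tr∈G {m} m∈F′ = carrier-TR⇒ G (proj₁ m∈F′) (proj₂ (∈lift⁻ F m∈F′))
      (∈preimage⁻ G (smallest (preimage G) (∈preimage⁺ G r∈𝒦 Tr∈G) (proj₁ (∈lift⁻ F m∈F′))))

    F′≢Mod : ¬ (carrier F′ ≐ Modular N)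
    F′≢Mod (F′⊆ , _) = F≢Mod
      ( (λ {s} s∈F → Modular-resp-≋ (R∘T s) (R-Modular (F′⊆ (T∈lift F s∈F))))
      , Modular⊆carrier F ne)

    atom′ : ∀ G → NonEmpty G → carrier G Pred.⊆ carrier F′ →
            carrier G ≐ Modular N ⊎ carrier G ≐ carrier F′
    -- The preimage of G lies below F, so atomicity of F applies to it. Both alternatives carry back
    -- to G because Φ vanishes on G and on F′.
    atom′ G G-ne G⊆F′ = Sum.map
      (λ (H⊆ , _) → (λ g∈G → Modular-R⇒ (proj₁ g∈G) (Φ≈0 g∈G) (H⊆ (R∈H g∈G)))
                  , Modular⊆carrier G G-ne)
      (λ (_ , F⊆H) → G⊆F′ , λ m∈F′ → carrier-TR⇒ G (proj₁ m∈F′) (proj₂ (∈lift⁻ F m∈F′))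
                                        (∈preimage⁻ G (F⊆H (proj₁ (∈lift⁻ F m∈F′)))))
      (atom (preimage G) (_ , R∈H (proj₂ G-ne)) λ s∈H → T∈lift⁻ F (G⊆F′ (∈preimage⁻ G s∈H)))
      where
      Φ≈0 : ∀ {g} → carrier G g → Φ g ≈ 0ℝ
      Φ≈0 g∈G = proj₂ (∈lift⁻ F (G⊆F′ g∈G))
      R∈H : ∀ {g} → carrier G g → carrier (preimage G) (R g)
      R∈H g∈G = ∈preimage⁺ G (R-𝒦 (proj₁ g∈G)) (carrier-TR G (Φ≈0 g∈G) g∈G)

  -- Now the smallest face at `T r` is pulled back, and faces of `𝒦 M` are lifted in order to be
  -- compared with it.
  Extreme-T⁻ : ∀ {r} → 𝒦 M r → Extreme N (T r) → Extreme M r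
  Extreme-T⁻ {r} r∈𝒦 (_ , F′ , (Tr∈F′ , smallest) , ne , F′≢Mod , atom) =
    r∈𝒦 , F , (r∈F , smallest′) , (r , r∈F) , F≢Mod , atom′
    where
    F = preimage F′

    r∈F : carrier F r
    r∈F = ∈preimage⁺ F′ r∈𝒦 Tr∈F′

    whole : Face (𝒦 M)
    whole = record { v = λ _ → 0ℝ ; k = 0ℝ ; valid = λ s _ → ≤-reflexive (represents zero-linear s) }

    -- F′ lies in the face Φ = 0, which is the lift of 𝒦 M.
    Φ≈0 : ∀ {g} → carrier F′ g → Φ g ≈ 0ℝ
    Φ≈0 g∈F′ = proj₂ (∈lift⁻ whole
      (smallest (lift whole) (T∈lift whole (r∈𝒦 , represents zero-linear r)) g∈F′))

    smallest′ : ∀ G → carrier G r → carrier F Pred.⊆ carrier G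
    smallest′ G r∈G s∈F = T∈lift⁻ G (smallest (lift G) (T∈lift G r∈G) (∈preimage⁻ F′ s∈F))

    F≢Mod : ¬ (carrier F ≐ Modular M)
    F≢Mod (F⊆ , _) = F′≢Mod
      ( (λ g∈F′ → Modular-R⇒ (proj₁ g∈F′) (Φ≈0 g∈F′)
          (F⊆ (∈preimage⁺ F′ (R-𝒦 (proj₁ g∈F′)) (carrier-TR F′ (Φ≈0 g∈F′) g∈F′))))
      , Modular⊆carrier F′ ne)

    atom′ : ∀ G → NonEmpty G → carrier G Pred.⊆ carrier F →
            carrier G ≐ Modular M ⊎ carrier G ≐ carrier F
    atom′ G (q , q∈G) G⊆F = Sum.map
      (λ (G′⊆ , _) → (λ {s} s∈G → Modular-resp-≋ (R∘T s) (R-Modular (G′⊆ (T∈lift G s∈G))))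
                   , Modular⊆carrier G (q , q∈G))
      (λ (_ , F′⊆G′) → G⊆F , λ s∈F → T∈lift⁻ G (F′⊆G′ (∈preimage⁻ F′ s∈F)))
      (atom (lift G) (T q , T∈lift G q∈G) λ m∈G′ →
        carrier-TR⇒ F′ (proj₁ m∈G′) (proj₂ (∈lift⁻ G m∈G′))
          (∈preimage⁻ F′ (G⊆F (proj₁ (∈lift⁻ G m∈G′)))))

-- Subsets

𝒫-≡ : ∀ {n} {N : Subset n} {S S′ : 𝒫 N} → value S ≡ value S′ → S ≡ S′
𝒫-≡ refl = refl

x∈p─q⇒x∉q : ∀ {n} {x : Fin n} (p q : Subset n) → x ∈ p ─ q → x ∉ q
x∈p─q⇒x∉q (inside ∷ p)  (outside ∷ q) here        ()
x∈p─q⇒x∉q (_ ∷ p)       (inside ∷ q)  (there x∈) (there x∈q) = x∈p─q⇒x∉q p q x∈ x∈q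
x∈p─q⇒x∉q (_ ∷ p)       (outside ∷ q) (there x∈) (there x∈q) = x∈p─q⇒x∉q p q x∈ x∈q

∪-distribʳ-∪ : ∀ {n} (p q r : Subset n) → (p Sub.∪ q) Sub.∪ r ≡ (p Sub.∪ r) Sub.∪ (q Sub.∪ r)
∪-distribʳ-∪ p q r = ⊆-antisym
  (λ i∈ → [ x∈p∪q⁺ ∘ Sum.map (p⊆p∪q r) (p⊆p∪q r) ∘ x∈p∪q⁻ p q
          , x∈p∪q⁺ ∘ inj₁ ∘ q⊆p∪q p r ]′ (x∈p∪q⁻ (p Sub.∪ q) r i∈))
  (λ i∈ → [ x∈p∪q⁺ ∘ Sum.map₁ (p⊆p∪q q) ∘ x∈p∪q⁻ p r
          , x∈p∪q⁺ ∘ Sum.map₁ (q⊆p∪q p q) ∘ x∈p∪q⁻ q r ]′ (x∈p∪q⁻ (p Sub.∪ r) (q Sub.∪ r) i∈))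

-- The step has to cope with an i that is already in S; in exchange the recursion on the bit vector
-- carries no membership proofs.
subset-induction : ∀ {n} (P : Subset n → Set) → P Sub.⊥ →
  (∀ S i → P S → P (Sub.⁅ i ⁆ Sub.∪ S)) → ∀ S → P S
subset-induction P base step []      = base
subset-induction P base step (b ∷ S) = insert b
  where
  P-outside : P (outside ∷ S)
  P-outside = subset-induction (P ∘ (outside ∷_)) base (λ S i → step (outside ∷ S) (suc i)) S
  insert : ∀ b → P (b ∷ S)
  insert false = P-outside
  -- Adjoining `zero` to `outside ∷ S` computes to `inside ∷ (⊥ ∪ S)`, so only the tail is
  -- rewritten.
  insert true  = subst (λ S → P (inside ∷ S)) (∪-identityˡ S) (step (outside ∷ S) zero P-outside)

module _ {n} {N : Subset n} where

  ∪-comm-𝒫 : (A B : 𝒫 N) → A ∪ B ≡ B ∪ A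
  ∪-comm-𝒫 A B = 𝒫-≡ (∪-comm (value A) (value B))

  ∩-comm-𝒫 : (A B : 𝒫 N) → A ∩ B ≡ B ∩ A
  ∩-comm-𝒫 A B = 𝒫-≡ (∩-comm (value A) (value B))

  disjoint⇒∩≡∅ : (A B : 𝒫 N) → (∀ {i} → i ∈ value A → i ∉ value B) → A ∩ B ≡ ∅
  disjoint⇒∩≡∅ A B disj = 𝒫-≡ (Empty-unique λ (i , i∈) →
    let i∈A , i∈B = x∈p∩q⁻ (value A) (value B) i∈ in disj i∈A i∈B)

  _∖𝒫_ : 𝒫 N → 𝒫 N → 𝒫 N
  (A , [ p ]) ∖𝒫 (B , _) = A ─ B , [ p ∘ p─q⊆p A B ]

  A∪[B∖A]≡A∪B : (A B : 𝒫 N) → A ∪ (B ∖𝒫 A) ≡ A ∪ B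
  A∪[B∖A]≡A∪B (A , _) (B , _) = 𝒫-≡ (⊆-antisym
    (λ i∈ → x∈p∪q⁺ (Sum.map id (p─q⊆p B A) (x∈p∪q⁻ A (B ─ A) i∈)))
    (λ {i} i∈ → x∈p∪q⁺ (split i (x∈p∪q⁻ A B i∈))))
    where
    split : ∀ i → i ∈ A ⊎ i ∈ B → i ∈ A ⊎ i ∈ B ─ A
    split i (inj₁ i∈A) = inj₁ i∈A
    split i (inj₂ i∈B) with i ∈? A
    ... | yes i∈A = inj₁ i∈A
    ... | no  i∉A = inj₂ (x∈p∧x∉q⇒x∈p─q i∈B i∉A)

  -- Both nonNeg and monotone come from  f A + f (B ∖ A) ≤ f (A ∪ B) + f ∅.
  module _ {f : SetFunction N} (f∈𝒦 : 𝒦 N f) (f∅≈0 : f ∅ ≈ 0ℝ) (0≤f⁅⁆ : ∀ i → 0ℝ ≤ f ⁅ i ⁆) where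

    superadditive : ∀ A B → A ∩ B ≡ ∅ → f A + f B ≤ f (A ∪ B)
    superadditive A B A∩B≡∅ = ≤-respʳ-≈
      (≈-trans (+-cong ≈-refl (≈-trans (≈-reflexive (cong f A∩B≡∅)) f∅≈0)) (+-identityʳ _)) (f∈𝒦 A B)

    nonNeg : ∀ A → 0ℝ ≤ f A
    -- The induction runs through all subsets of `Fin n`, so inclusion in N is made part of the
    -- predicate.
    nonNeg (A , [ A⊆N ]) = subset-induction
      (λ A → .(p : A ⊆ N) → 0ℝ ≤ f (A , [ p ])) (λ _ → ≤-reflexive (≈-sym f∅≈0)) insert A A⊆N
      where
      insert : ∀ S i → (.(p : S ⊆ N) → 0ℝ ≤ f (S , [ p ])) →
               .(p : Sub.⁅ i ⁆ Sub.∪ S ⊆ N) → 0ℝ ≤ f (Sub.⁅ i ⁆ Sub.∪ S , [ p ])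
      insert S i 0≤fS p with i ∈? S
      ... | yes i∈S = subst (λ A → 0ℝ ≤ f A) (𝒫-≡ (⊆-antisym (q⊆p∪q Sub.⁅ i ⁆ S)
              (λ j∈ → [ (λ j∈i → subst (_∈ S) (sym (x∈⁅y⁆⇒x≡y i j∈i)) i∈S) , id ]′ (x∈p∪q⁻ Sub.⁅ i ⁆ S j∈))))
              (0≤fS (λ j∈ → p (q⊆p∪q Sub.⁅ i ⁆ S j∈)))
      ... | no i∉S = subst (λ A → 0ℝ ≤ f A) (𝒫-≡ refl) (≤-trans
              (≤-respˡ-≈ (+-identityˡ 0ℝ) (+-mono-≤ (0≤f⁅⁆ i′) (0≤fS (λ j∈ → p (q⊆p∪q Sub.⁅ i ⁆ S j∈)))))
              (superadditive ⁅ i′ ⁆ S′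
                (disjoint⇒∩≡∅ ⁅ i′ ⁆ S′
                  λ j∈i j∈S → i∉S (subst (_∈ S) (x∈⁅y⁆⇒x≡y i j∈i) j∈S))))
        where
        i′ : Element N
        i′ = i , [ p (p⊆p∪q S (x∈⁅x⁆ i)) ]
        S′ : 𝒫 N
        S′ = S , [ (λ j∈ → p (q⊆p∪q Sub.⁅ i ⁆ S j∈)) ]

    monotone : ∀ A B → f A ≤ f (A ∪ B)
    monotone A B = ≤-respʳ-≈ (≈-reflexive (cong f (A∪[B∖A]≡A∪B A B)))
      (≤-trans (≤-respˡ-≈ (+-identityʳ _) (+-mono-≤ ≤-refl (nonNeg (B ∖𝒫 A))))
        (superadditive A (B ∖𝒫 A) (disjoint⇒∩≡∅ A (B ∖𝒫 A)
          λ i∈A i∈B∖A → x∈p─q⇒x∉q (value B) (value A) i∈B∖A i∈A)))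

-- Lower standardization

sum-zero : ∀ {k} {f : Fin k → ℝ} → (∀ i → f i ≈ 0ℝ) → sum f ≈ 0ℝ
sum-zero {zero}  h = ≈-refl
sum-zero {suc k} h = ≈-trans (+-cong (h zero) (sum-zero (h ∘ suc))) (+-identityˡ 0ℝ)

sum-single : ∀ {k} (i : Fin k) {f : Fin k → ℝ} → (∀ j → j ≢ i → f j ≈ 0ℝ) → sum f ≈ f i
sum-single zero    h = ≈-trans (+-cong ≈-refl (sum-zero λ j → h (suc j) λ ())) (+-identityʳ _)
sum-single (suc i) h = ≈-trans
  (+-cong (h zero λ ()) (sum-single i λ j j≢i → h (suc j) (j≢i ∘ Fin.suc-injective))) (+-identityˡ _)

module _ {n} {M : Subset n} where

  -- The sum in the lower standardization, isolated because it is modular in S and linear in r.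
  correction : SetFunction M → SetFunction M
  correction r (S , [ S⊆M ]) = ∑∈ S (λ i i∈S → r ∅ - r ⁅ i , [ S⊆M i∈S ] ⁆)

  correction-linear : LinearMap correction
  correction-linear (S , [ S⊆M ]) = ∑∈-linear S λ i i∈S →
    +-linear (evaluation-linear ∅) (neg-linear (evaluation-linear ⁅ i , [ S⊆M i∈S ] ⁆))

  lowerStandardization-linear : LinearMap (lowerStandardization {M = M})
  lowerStandardization-linear S = +-linear
    (+-linear (evaluation-linear S) (neg-linear (evaluation-linear ∅))) (correction-linear S)

  -- Used to show that two functions agreeing on ∅ and on singletons have the same correction at
  -- every S, even if they differ elsewhere.
  correction-cong : ∀ (r s : SetFunction M) → r ∅ ≈ s ∅ → (∀ i → r ⁅ i ⁆ ≈ s ⁅ i ⁆) →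
    ∀ S → correction r S ≈ correction s S
  correction-cong r s r∅≈s∅ r⁅⁆≈s⁅⁆ (S , [ S⊆M ]) = sum-cong-≋ λ i →
    ifTrue-cong (i ∈? S) λ i∈S → +-cong r∅≈s∅ (-‿cong (r⁅⁆≈s⁅⁆ (i , [ S⊆M i∈S ])))

  module _ (r : SetFunction M) where

    correction-∅ : correction r ∅ ≈ 0ℝ
    correction-∅ = sum-zero {n} λ i →
      ≈-reflexive (ifTrue-no (i ∈? Sub.⊥) (λ p → r ∅ - r ⁅ i , [ ⊥-elim (∉⊥ p) ] ⁆) ∉⊥)

    correction-⁅⁆ : ∀ i → correction r ⁅ i ⁆ ≈ r ∅ - r ⁅ i ⁆
    correction-⁅⁆ (i , _) = ≈-trans
      (sum-single i λ j j≢i → ≈-reflexive (ifTrue-no (j ∈? Sub.⁅ i ⁆) _ (x≢y⇒x∉⁅y⁆ j≢i)))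
      (≈-reflexive (ifTrue-yes (i ∈? Sub.⁅ i ⁆) _ (x∈⁅x⁆ i)))

    -- For each i, as many of A, B contain i as of A ∪ B, A ∩ B, so the summands balance index by
    -- index.
    correction-modular : ∀ A B →
      correction r A + correction r B ≈ correction r (A ∪ B) + correction r (A ∩ B)
    correction-modular (A , [ A⊆M ]) (B , [ B⊆M ]) = ≈-trans
      (≈-sym (∑-distrib-+ (λ i → ifTrue (i ∈? A) (λ p → w i (A⊆M p)))
                          (λ i → ifTrue (i ∈? B) (λ p → w i (B⊆M p)))))
      (≈-trans (sum-cong-≋ term)
        (∑-distrib-+ (λ i → ifTrue (i ∈? A Sub.∪ B) (λ p → w i ([ A⊆M , B⊆M ]′ (x∈p∪q⁻ A B p))))
                     (λ i → ifTrue (i ∈? A Sub.∩ B) (λ p → w i (A⊆M (p∩q⊆p A B p))))))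
      where
      w : (i : Fin n) → .(i ∈ M) → ℝ
      w i i∈M = r ∅ - r ⁅ i , [ i∈M ] ⁆

      term : ∀ i →
        ifTrue (i ∈? A) (λ p → w i (A⊆M p)) + ifTrue (i ∈? B) (λ p → w i (B⊆M p)) ≈
        ifTrue (i ∈? A Sub.∪ B) (λ p → w i ([ A⊆M , B⊆M ]′ (x∈p∪q⁻ A B p))) +
        ifTrue (i ∈? A Sub.∩ B) (λ p → w i (A⊆M (p∩q⊆p A B p)))
      term i with i ∈? A | i ∈? B
      ... | yes i∈A | yes i∈B = ≈-sym (+-cong
        (≈-reflexive (ifTrue-yes (i ∈? A Sub.∪ B) _ (x∈p∪q⁺ (inj₁ i∈A))))
        (≈-reflexive (ifTrue-yes (i ∈? A Sub.∩ B) _ (x∈p∩q⁺ (i∈A , i∈B)))))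
      ... | yes i∈A | no i∉B = ≈-sym (+-cong
        (≈-reflexive (ifTrue-yes (i ∈? A Sub.∪ B) _ (x∈p∪q⁺ (inj₁ i∈A))))
        (≈-reflexive (ifTrue-no (i ∈? A Sub.∩ B) _ (i∉B ∘ p∩q⊆q A B))))
      ... | no i∉A | yes i∈B = ≈-sym (≈-trans (+-cong
        (≈-reflexive (ifTrue-yes (i ∈? A Sub.∪ B) _ (x∈p∪q⁺ (inj₂ i∈B))))
        (≈-reflexive (ifTrue-no (i ∈? A Sub.∩ B) _ (i∉A ∘ p∩q⊆p A B))))
        (+-comm _ _))
      ... | no i∉A | no i∉B = ≈-sym (+-cong
        (≈-reflexive (ifTrue-no (i ∈? A Sub.∪ B) _ ([ i∉A , i∉B ]′ ∘ x∈p∪q⁻ A B)))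
        (≈-reflexive (ifTrue-no (i ∈? A Sub.∩ B) _ (i∉A ∘ p∩q⊆p A B))))

    lowerStandardization-∅ : lowerStandardization r ∅ ≈ 0ℝ
    lowerStandardization-∅ = ≈-via correction-∅
      (solve 2 (λ a b → (a :- a :+ b) :- con 0ℚ := b :- con 0ℚ) ≈-refl (r ∅) (correction r ∅))

    lowerStandardization-⁅⁆ : ∀ i → lowerStandardization r ⁅ i ⁆ ≈ 0ℝ
    lowerStandardization-⁅⁆ i = ≈-via (correction-⁅⁆ i)
      (solve 3 (λ a b c → (a :- b :+ c) :- con 0ℚ := c :- (b :- a)) ≈-refl
        (r ⁅ i ⁆) (r ∅) (correction r ⁅ i ⁆))

    lowerStandardization-𝒦 : 𝒦 M r → 𝒦 M (lowerStandardization r)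
    lowerStandardization-𝒦 r∈𝒦 A B = ≤-via
      (+-mono-≤ (r∈𝒦 A B) (≤-reflexive (correction-modular A B)))
      (solve 9 (λ z a b c d a′ b′ c′ d′ →
          ((c :- z :+ c′) :+ (d :- z :+ d′)) :- ((a :- z :+ a′) :+ (b :- z :+ b′))
            := ((c :+ d) :+ (c′ :+ d′)) :- ((a :+ b) :+ (a′ :+ b′)))
        ≈-refl (r ∅) (r A) (r B) (r (A ∪ B)) (r (A ∩ B))
        (correction r A) (correction r B) (correction r (A ∪ B)) (correction r (A ∩ B)))

    -- The standardization adds a modular function to r, hence stays supermodular; its vanishing on
    -- ∅ and on singletons supplies the other premises of `nonNeg`.
    lowerStandardization-nonNeg : 𝒦 M r → ∀ A → 0ℝ ≤ lowerStandardization r A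
    lowerStandardization-nonNeg r∈𝒦 = nonNeg (lowerStandardization-𝒦 r∈𝒦)
      lowerStandardization-∅ (≤-reflexive ∘ ≈-sym ∘ lowerStandardization-⁅⁆)

    lowerStandardization-mono : 𝒦 M r → ∀ A B → lowerStandardization r A ≤ lowerStandardization r (A ∪ B)
    lowerStandardization-mono r∈𝒦 = monotone (lowerStandardization-𝒦 r∈𝒦)
      lowerStandardization-∅ (≤-reflexive ∘ ≈-sym ∘ lowerStandardization-⁅⁆)

    -- The modular function that agrees with r on ∅ and on singletons. It is the branch of the
    -- extension used for sets that miss x.
    modularPart : SetFunction M
    modularPart S = r S - lowerStandardization r S

    modularPart≈ : ∀ S → modularPart S ≈ r ∅ - correction r S
    modularPart≈ S = solve 3 (λ a b c → a :- (a :- b :+ c) := b :- c) ≈-refl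
      (r S) (r ∅) (correction r S)

    modularPart-modular : ∀ A B →
      modularPart A + modularPart B ≈ modularPart (A ∪ B) + modularPart (A ∩ B)
    modularPart-modular A B = ≈-via (≈-sym (correction-modular A B))
      (≈-trans (+-cong (+-cong (modularPart≈ A) (modularPart≈ B))
                       (-‿cong (+-cong (modularPart≈ (A ∪ B)) (modularPart≈ (A ∩ B)))))
        (solve 5 (λ z a b c d → ((z :- a) :+ (z :- b)) :- ((z :- c) :+ (z :- d)) := (c :+ d) :- (a :+ b))
          ≈-refl (r ∅) (correction r A) (correction r B) (correction r (A ∪ B)) (correction r (A ∩ B))))

    modularPart-∅ : modularPart ∅ ≈ r ∅
    modularPart-∅ = ≈-via (≈-sym lowerStandardization-∅)
      (solve 2 (λ a b → (a :- b) :- a := con 0ℚ :- b) ≈-refl (r ∅) (lowerStandardization r ∅))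

    modularPart-⁅⁆ : ∀ i → modularPart ⁅ i ⁆ ≈ r ⁅ i ⁆
    modularPart-⁅⁆ i = ≈-via (≈-sym (lowerStandardization-⁅⁆ i))
      (solve 2 (λ a b → (a :- b) :- a := con 0ℚ :- b) ≈-refl (r ⁅ i ⁆) (lowerStandardization r ⁅ i ⁆))

-- Lower modular extension

module _ {n} {N M : Subset n} where

  ↾-≡ : ∀ (A B : 𝒫 N) → (∀ {i} → i ∈ M → i ∈ value A → i ∈ value B) →
        (∀ {i} → i ∈ M → i ∈ value B → i ∈ value A) → A ↾ M ≡ B ↾ M
  ↾-≡ (A , _) (B , _) f g = 𝒫-≡ (⊆-antisym
    (λ i∈ → let i∈A , i∈M = x∈p∩q⁻ A M i∈ in x∈p∩q⁺ (f i∈M i∈A , i∈M))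
    (λ i∈ → let i∈B , i∈M = x∈p∩q⁻ B M i∈ in x∈p∩q⁺ (g i∈M i∈B , i∈M)))

  ↾-∪ : (A B : 𝒫 N) → (A ∪ B) ↾ M ≡ (A ↾ M) ∪ (B ↾ M)
  ↾-∪ (A , _) (B , _) = 𝒫-≡ (∩-distribʳ-∪ M A B)

  ↾-∩ : (A B : 𝒫 N) → (A ∩ B) ↾ M ≡ (A ↾ M) ∩ (B ↾ M)
  ↾-∩ (A , _) (B , _) = 𝒫-≡ (⊆-antisym
    (λ i∈ → let i∈A∩B , i∈M = x∈p∩q⁻ (A Sub.∩ B) M i∈
                i∈A , i∈B = x∈p∩q⁻ A B i∈A∩B
            in x∈p∩q⁺ (x∈p∩q⁺ (i∈A , i∈M) , x∈p∩q⁺ (i∈B , i∈M)))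
    (λ i∈ → let i∈A∩M , i∈B∩M = x∈p∩q⁻ (A Sub.∩ M) (B Sub.∩ M) i∈
                i∈A , i∈M = x∈p∩q⁻ A M i∈A∩M
            in x∈p∩q⁺ (x∈p∩q⁺ (i∈A , p∩q⊆p B M i∈B∩M) , i∈M)))

-- Extension by a single point x.

module _ {n} {N : Subset n} {x : Fin n} (x∈N : x ∈ N) where

  private
    M : Subset n
    M = N ∖ x

    T : SetFunction M → SetFunction N
    T = lowerModularExtension

    ⁅x⁆ : 𝒫 N
    ⁅x⁆ = ⁅ x , [ x∈N ] ⁆

    x∉M : x ∉ M
    x∉M x∈M = x∈p─q⇒x∉q N Sub.⁅ x ⁆ x∈M (x∈⁅x⁆ x)

    ∈M⇒≢x : ∀ {i} → i ∈ M → i ≢ x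
    ∈M⇒≢x i∈M refl = x∉M i∈M

  -- Since N ∖ M consists of x alone, the test in the definition of the extension amounts to x ∈ S.
  N─M⊆ : ∀ {S : Subset n} → x ∈ S → N ─ M ⊆ S
  N─M⊆ {S} x∈S {i} i∈N─M with i Fin.≟ x
  ... | yes refl = x∈S
  ... | no i≢x   = ⊥-elim (x∈p─q⇒x∉q N M i∈N─M (x∈p∧x≢y⇒x∈p-y (p─q⊆p N M i∈N─M) i≢x))

  T-∈ : ∀ r S → x ∈ value S → T r S ≡ r (S ↾ M)
  T-∈ r S x∈S = cong (λ b → if b then r (S ↾ M) else modularPart r (S ↾ M))
    (dec-true (N ─ M ⊆? value S) (N─M⊆ x∈S))

  T-∉ : ∀ r S → x ∉ value S → T r S ≡ modularPart r (S ↾ M)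
  T-∉ r S x∉S = cong (λ b → if b then r (S ↾ M) else modularPart r (S ↾ M))
    (dec-false (N ─ M ⊆? value S) (λ N─M⊆S → x∉S (N─M⊆S (x∈p∧x∉q⇒x∈p─q x∈N x∉M))))

  widen : 𝒫 M → 𝒫 N
  widen (S , [ S⊆M ]) = S , [ p─q⊆p N Sub.⁅ x ⁆ ∘ S⊆M ]

  restriction : SetFunction N → SetFunction M
  restriction m S = m (widen S)

  link : SetFunction N → SetFunction M
  link m S = m (widen S ∪ ⁅x⁆)

  x∉widen : ∀ S → x ∉ value (widen S)
  x∉widen (S , [ S⊆M ]) x∈S = ⊥-elim-irr (x∉M (S⊆M x∈S))

  widen-↾ : ∀ S → widen S ↾ M ≡ S
  widen-↾ (S , [ S⊆M ]) = 𝒫-≡ (⊆-antisym (p∩q⊆p S M) (λ i∈S → x∈p∩q⁺ (i∈S , recompute (_ ∈? M) (S⊆M i∈S))))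

  [widen∪x]-↾ : ∀ S → (widen S ∪ ⁅x⁆) ↾ M ≡ S
  [widen∪x]-↾ S = trans (↾-≡ (widen S ∪ ⁅x⁆) (widen S)
    (λ i∈M i∈ → [ id , (λ i∈⁅x⁆ → ⊥-elim (∈M⇒≢x i∈M (x∈⁅y⁆⇒x≡y x i∈⁅x⁆))) ]′ (x∈p∪q⁻ (value S) Sub.⁅ x ⁆ i∈))
    (λ i∈M i∈S → p⊆p∪q Sub.⁅ x ⁆ i∈S)) (widen-↾ S)

  widen-↾∪x : ∀ S → x ∈ value S → widen (S ↾ M) ∪ ⁅x⁆ ≡ S
  widen-↾∪x (S , [ S⊆N ]) x∈S = 𝒫-≡ (⊆-antisym
    (λ i∈ → [ p∩q⊆p S M , (λ i∈x → subst (_∈ S) (sym (x∈⁅y⁆⇒x≡y x i∈x)) x∈S) ]′ (x∈p∪q⁻ (S Sub.∩ M) Sub.⁅ x ⁆ i∈))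
    (λ {i} i∈S → x∈p∪q⁺ (split i i∈S)))
    where
    split : ∀ i → i ∈ S → i ∈ S Sub.∩ M ⊎ i ∈ Sub.⁅ x ⁆
    split i i∈S with i Fin.≟ x
    ... | yes refl = inj₂ (x∈⁅x⁆ x)
    ... | no i≢x = inj₁ (x∈p∩q⁺ (i∈S , x∈p∧x≢y⇒x∈p-y (recompute (i ∈? N) (S⊆N i∈S)) i≢x))

  widen-↾-∉ : ∀ S → x ∉ value S → widen (S ↾ M) ≡ S
  widen-↾-∉ (S , [ S⊆N ]) x∉S = 𝒫-≡ (⊆-antisym (p∩q⊆p S M)
    (λ i∈S → x∈p∩q⁺ (i∈S , x∈p∧x≢y⇒x∈p-y (recompute (_ ∈? N) (S⊆N i∈S)) λ { refl → x∉S i∈S })))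

  restriction-𝒦 : ∀ {m} → 𝒦 N m → 𝒦 M (restriction m)
  restriction-𝒦 m∈𝒦 A B = m∈𝒦 (widen A) (widen B)

  link-𝒦 : ∀ {m} → 𝒦 N m → 𝒦 M (link m)
  link-𝒦 {m} m∈𝒦 A B = subst₂ (λ U I → link m A + link m B ≤ m U + m I)
    (𝒫-≡ (sym (∪-distribʳ-∪ (value A) (value B) Sub.⁅ x ⁆)))
    (𝒫-≡ (sym (∪-distribʳ-∩ Sub.⁅ x ⁆ (value A) (value B))))
    (m∈𝒦 (widen A ∪ ⁅x⁆) (widen B ∪ ⁅x⁆))

  -- The branch is chosen by S alone, so at a fixed S the value is one of two linear functionals of
  -- r.
  T-linear : LinearMap T
  T-linear S with does (N ─ M ⊆? value S)
  ... | true  = evaluation-linear (S ↾ M)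
  ... | false = +-linear (evaluation-linear (S ↾ M)) (neg-linear (lowerStandardization-linear (S ↾ M)))

  T-∪-∈ : ∀ r A B → x ∈ value (A ∪ B) → T r (A ∪ B) ≡ r ((A ↾ M) ∪ (B ↾ M))
  T-∪-∈ r A B x∈ = trans (T-∈ r (A ∪ B) x∈) (cong r (↾-∪ A B))

  T-∪-∉ : ∀ r A B → x ∉ value (A ∪ B) → T r (A ∪ B) ≡ modularPart r ((A ↾ M) ∪ (B ↾ M))
  T-∪-∉ r A B x∉ = trans (T-∉ r (A ∪ B) x∉) (cong (modularPart r) (↾-∪ A B))

  T-∩-∈ : ∀ r A B → x ∈ value (A ∩ B) → T r (A ∩ B) ≡ r ((A ↾ M) ∩ (B ↾ M))
  T-∩-∈ r A B x∈ = trans (T-∈ r (A ∩ B) x∈) (cong r (↾-∩ A B))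

  T-∩-∉ : ∀ r A B → x ∉ value (A ∩ B) → T r (A ∩ B) ≡ modularPart r ((A ↾ M) ∩ (B ↾ M))
  T-∩-∉ r A B x∉ = trans (T-∉ r (A ∩ B) x∉) (cong (modularPart r) (↾-∩ A B))

  -- All four sets miss x, so only values of the modular function `modularPart r` occur.
  T-modular-∉ : ∀ r A B → x ∉ value A → x ∉ value B → T r A + T r B ≈ T r (A ∪ B) + T r (A ∩ B)
  T-modular-∉ r A B x∉A x∉B = ≈-trans
    (+-cong (≈-reflexive (T-∉ r A x∉A)) (≈-reflexive (T-∉ r B x∉B)))
    (≈-trans (modularPart-modular r (A ↾ M) (B ↾ M))
      (≈-sym (+-cong (≈-reflexive (T-∪-∉ r A B ([ x∉A , x∉B ]′ ∘ x∈p∪q⁻ (value A) (value B))))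
                     (≈-reflexive (T-∩-∉ r A B (x∉A ∘ p∩q⊆p (value A) (value B)))))))

  -- modularPart r is modular, so the increase of T r over that of
  -- modularPart r is the increase of the monotone lowerStandardization r.
  T-∈-∉ : ∀ {r} → 𝒦 M r → ∀ A B → x ∈ value A → x ∉ value B → T r A + T r B ≤ T r (A ∪ B) + T r (A ∩ B)
  T-∈-∉ {r} r∈𝒦 A B x∈A x∉B =
    ≤-respˡ-≈ (+-cong (≈-reflexive (sym (T-∈ r A x∈A))) (≈-reflexive (sym (T-∉ r B x∉B))))
    (≤-respʳ-≈ (+-cong (≈-reflexive (sym (T-∪-∈ r A B (p⊆p∪q (value B) x∈A))))
                       (≈-reflexive (sym (T-∩-∉ r A B (x∉B ∘ p∩q⊆q (value A) (value B))))))
      (≤-via (+-mono-≤ (lowerStandardization-mono r r∈𝒦 a b) (≤-reflexive (modularPart-modular r a b)))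
        (solve 6 (λ ra ℓa mb rab ℓab mi → (rab :+ mi) :- (ra :+ mb)
                     := (ℓab :+ ((rab :- ℓab) :+ mi)) :- (ℓa :+ ((ra :- ℓa) :+ mb)))
          ≈-refl (r a) (lowerStandardization r a) (modularPart r b)
                 (r (a ∪ b)) (lowerStandardization r (a ∪ b)) (modularPart r (a ∩ b)))))
    where
    a b : 𝒫 M
    a = A ↾ M
    b = B ↾ M

  -- If both sets contain x, this is supermodularity of r; if neither does, equality holds; the
  -- mixed case rests on monotonicity of the lower standardization.
  T-𝒦 : ∀ {r} → 𝒦 M r → 𝒦 N (T r)
  T-𝒦 {r} r∈𝒦 A B = cases (x ∈? value A) (x ∈? value B)
    where
    cases : Dec (x ∈ value A) → Dec (x ∈ value B) → T r A + T r B ≤ T r (A ∪ B) + T r (A ∩ B)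
    cases (yes x∈A) (yes x∈B) =
      ≤-respˡ-≈ (+-cong (≈-reflexive (sym (T-∈ r A x∈A))) (≈-reflexive (sym (T-∈ r B x∈B))))
      (≤-respʳ-≈ (+-cong (≈-reflexive (sym (T-∪-∈ r A B (p⊆p∪q (value B) x∈A))))
                         (≈-reflexive (sym (T-∩-∈ r A B (x∈p∩q⁺ (x∈A , x∈B))))))
        (r∈𝒦 (A ↾ M) (B ↾ M)))
    cases (yes x∈A) (no x∉B) = T-∈-∉ r∈𝒦 A B x∈A x∉B
    cases (no x∉A) (yes x∈B) = ≤-respˡ-≈ (+-comm (T r B) (T r A))
      (≤-respʳ-≈ (≈-reflexive (cong₂ _+_ (cong (T r) (∪-comm-𝒫 B A))
                                         (cong (T r) (∩-comm-𝒫 B A))))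
        (T-∈-∉ r∈𝒦 B A x∈B x∉A))
    cases (no x∉A) (no x∉B) = ≤-reflexive (T-modular-∉ r A B x∉A x∉B)

  link-T : ∀ r S → link (T r) S ≡ r S
  link-T r S = trans (T-∈ r (widen S ∪ ⁅x⁆) (q⊆p∪q (value S) Sub.⁅ x ⁆ (x∈⁅x⁆ x))) (cong r ([widen∪x]-↾ S))

  restriction-T : ∀ r S → restriction (T r) S ≡ modularPart r S
  restriction-T r S = trans (T-∉ r (widen S) (x∉widen S)) (cong (modularPart r) (widen-↾ S))

  -- The converse holds because `link` preserves supermodularity and recovers r from `T r`.
  T∈𝒦⇔ : ∀ r → 𝒦 N (T r) ⇔ 𝒦 M r
  T∈𝒦⇔ r = mk⇔ (λ Tr∈𝒦 → 𝒦-resp-≋ (λ S → ≈-reflexive (link-T r S)) (link-𝒦 Tr∈𝒦)) T-𝒦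

  -- gap m S is the sum over i ∈ S of  m(ix) + m(∅) − m(i) − m(x).  For m in
  -- 𝒦 N, both summands of Φ m are nonnegative; the first vanishes iff m is
  -- modular on 𝒫 M, the second iff i ⊥ x | ∅ for all i ∈ M.
  gap : SetFunction N → SetFunction M
  gap m S = correction (restriction m) S - correction (link m) S

  whole : 𝒫 M
  whole = M , [ id ]

  Φ : SetFunction N → ℝ
  Φ m = lowerStandardization (restriction m) whole + gap m whole

  link-linear : LinearMap link
  link-linear S = evaluation-linear (widen S ∪ ⁅x⁆)

  restriction-linear : LinearMap restriction
  restriction-linear S = evaluation-linear (widen S)

  Φ-linear : Linear Φ
  Φ-linear = +-linear (∘-linear (lowerStandardization-linear whole) restriction-linear)
    (+-linear (∘-linear (correction-linear whole) restriction-linear)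
              (neg-linear (∘-linear (correction-linear whole) link-linear)))

  gap-∅ : ∀ m → gap m ∅ ≈ 0ℝ
  gap-∅ m = ≈-via (+-cong (correction-∅ (restriction m)) (-‿cong (correction-∅ (link m))))
    (solve 1 (λ a → a :- con 0ℚ := a :- (con 0ℚ :- con 0ℚ)) ≈-refl (gap m ∅))

  -- This is the supermodular inequality for the disjoint singletons i and x.
  gap-⁅⁆ : ∀ {m} → 𝒦 N m → ∀ i → 0ℝ ≤ gap m ⁅ i ⁆
  gap-⁅⁆ {m} m∈𝒦 i = ≤-respʳ-≈
    (≈-sym (+-cong (correction-⁅⁆ (restriction m) i) (-‿cong (correction-⁅⁆ (link m) i))))
    (≤-via (m∈𝒦 (widen ⁅ i ⁆) ⁅x⁆)
      (≈-trans
        (+-cong (+-cong ≈-refl (-‿cong (+-cong (≈-reflexive (cong m ∅∪x≡x)) ≈-refl))) ≈-refl)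
        (≈-trans
          (solve 4 (λ e ix x i → (e :- i) :- (x :- ix) :- con 0ℚ := (ix :+ e) :- (i :+ x)) ≈-refl
            (m ∅) (m (widen ⁅ i ⁆ ∪ ⁅x⁆)) (m ⁅x⁆) (m (widen ⁅ i ⁆)))
          (+-cong (+-cong ≈-refl (≈-reflexive (cong m (sym (disjoint⇒∩≡∅ (widen ⁅ i ⁆) ⁅x⁆
            λ j∈i j∈x → x∉widen ⁅ i ⁆ (subst (_∈ _) (x∈⁅y⁆⇒x≡y x j∈x) j∈i)))))) ≈-refl))))
    where
    ∅∪x≡x : widen ∅ ∪ ⁅x⁆ ≡ ⁅x⁆
    ∅∪x≡x = 𝒫-≡ (∪-identityˡ Sub.⁅ x ⁆)

  -- A difference of two modular functions is modular.
  gap-𝒦 : ∀ m → 𝒦 M (gap m)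
  gap-𝒦 m A B = ≤-reflexive (≈-via
    (+-cong (correction-modular s A B) (≈-sym (correction-modular l A B)))
    (solve 8 (λ a b c d e f g h → ((a :- b) :+ (c :- d)) :- ((e :- f) :+ (g :- h))
        := ((a :+ c) :+ (f :+ h)) :- ((e :+ g) :+ (b :+ d)))
      ≈-refl (correction s A) (correction l A) (correction s B) (correction l B)
             (correction s (A ∪ B)) (correction l (A ∪ B)) (correction s (A ∩ B)) (correction l (A ∩ B))))
    where
    s l : SetFunction M
    s = restriction m
    l = link m

  Φ-nonNeg : ∀ {m} → 𝒦 N m → 0ℝ ≤ Φ m
  Φ-nonNeg {m} m∈𝒦 = ≤-respˡ-≈ (+-identityˡ 0ℝ)
    (+-mono-≤ (lowerStandardization-nonNeg (restriction m) (restriction-𝒦 m∈𝒦) whole)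
              (nonNeg (gap-𝒦 m) (gap-∅ m) (gap-⁅⁆ m∈𝒦) whole))

  -- Below M, `T r` is already modular, so its standardization vanishes. Its restriction and its
  -- link agree on ∅ and on singletons, so the gap vanishes too.
  Φ-T : ∀ r → Φ (T r) ≈ 0ℝ
  Φ-T r = ≈-trans (+-cong ℓ≈0 gap≈0) (+-identityˡ 0ℝ)
    where
    s : SetFunction M
    s = restriction (T r)
    s∅≈r∅ : s ∅ ≈ r ∅
    s∅≈r∅ = ≈-trans (≈-reflexive (restriction-T r ∅)) (modularPart-∅ r)
    s⁅⁆≈r⁅⁆ : ∀ i → s ⁅ i ⁆ ≈ r ⁅ i ⁆
    s⁅⁆≈r⁅⁆ i = ≈-trans (≈-reflexive (restriction-T r ⁅ i ⁆)) (modularPart-⁅⁆ r i)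
    ℓ≈0 : lowerStandardization s whole ≈ 0ℝ
    ℓ≈0 = ≈-trans
      (+-cong (+-cong (≈-trans (≈-reflexive (restriction-T r whole)) (modularPart≈ r whole))
                      (-‿cong s∅≈r∅))
              (correction-cong s r s∅≈r∅ s⁅⁆≈r⁅⁆ whole))
      (solve 2 (λ a b → (a :- b) :- a :+ b := con 0ℚ) ≈-refl (r ∅) (correction r whole))
    gap≈0 : gap (T r) whole ≈ 0ℝ
    gap≈0 = ≈-trans
      (+-cong (correction-cong s (link (T r)) (≈-trans s∅≈r∅ (≈-reflexive (sym (link-T r ∅))))
                (λ i → ≈-trans (s⁅⁆≈r⁅⁆ i) (≈-reflexive (sym (link-T r ⁅ i ⁆)))) whole) ≈-refl)
      (-‿inverseʳ _)

  -- Such a d is c times the indicator of x ∉ S, and membership of x is counted equally by A, B and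
  -- by A ∪ B, A ∩ B.
  two-valued-modular : ∀ {d : SetFunction N} {c} →
    (∀ S → x ∈ value S → d S ≈ 0ℝ) → (∀ S → x ∉ value S → d S ≈ c) → Modular N d
  two-valued-modular {d} {c} d-∈ d-∉ = ≈⇒Modular λ A B → cases A B (x ∈? value A) (x ∈? value B)
    where
    cases : ∀ A B → Dec (x ∈ value A) → Dec (x ∈ value B) → d A + d B ≈ d (A ∪ B) + d (A ∩ B)
    cases A B (yes x∈A) (yes x∈B) = ≈-trans (+-cong (d-∈ A x∈A) (d-∈ B x∈B))
      (≈-sym (+-cong (d-∈ (A ∪ B) (p⊆p∪q (value B) x∈A)) (d-∈ (A ∩ B) (x∈p∩q⁺ (x∈A , x∈B)))))
    cases A B (yes x∈A) (no x∉B) = ≈-trans (+-cong (d-∈ A x∈A) (d-∉ B x∉B))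
      (≈-sym (+-cong (d-∈ (A ∪ B) (p⊆p∪q (value B) x∈A)) (d-∉ (A ∩ B) (x∉B ∘ p∩q⊆q (value A) (value B)))))
    cases A B (no x∉A) (yes x∈B) = ≈-trans (+-comm (d A) (d B)) (≈-trans (+-cong (d-∈ B x∈B) (d-∉ A x∉A))
      (≈-sym (+-cong (d-∈ (A ∪ B) (q⊆p∪q (value A) (value B) x∈B)) (d-∉ (A ∩ B) (x∉A ∘ p∩q⊆p (value A) (value B))))))
    cases A B (no x∉A) (no x∉B) = ≈-trans (+-cong (d-∉ A x∉A) (d-∉ B x∉B))
      (≈-sym (+-cong (d-∉ (A ∪ B) ([ x∉A , x∉B ]′ ∘ x∈p∪q⁻ (value A) (value B)))
                     (d-∉ (A ∩ B) (x∉A ∘ p∩q⊆p (value A) (value B)))))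

  -- The two functions agree on sets containing x. Vanishing of both summands of Φ makes their
  -- difference constant on sets that miss x.
  T-link : ∀ {m} → 𝒦 N m → Φ m ≈ 0ℝ → Modular N (λ S → m S - T (link m) S)
  T-link {m} m∈𝒦 Φm≈0 = two-valued-modular {c = s ∅ - l ∅} inside-x outside-x
    where
    s l : SetFunction M
    s = restriction m
    l = link m
    S∪whole : ∀ S → S ∪ whole ≡ whole
    S∪whole (S , [ S⊆M ]) = 𝒫-≡ (⊆-antisym
      (λ i∈ → [ (λ i∈S → recompute (_ ∈? M) (S⊆M i∈S)) , id ]′ (x∈p∪q⁻ S M i∈)) (q⊆p∪q S M))

    ℓ≥0 : ∀ S → 0ℝ ≤ lowerStandardization s S
    ℓ≥0 = lowerStandardization-nonNeg s (restriction-𝒦 m∈𝒦)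
    gap≥0 : ∀ S → 0ℝ ≤ gap m S
    gap≥0 = nonNeg (gap-𝒦 m) (gap-∅ m) (gap-⁅⁆ m∈𝒦)

    -- Monotonicity gives 0 ≤ ℓ(S) ≤ ℓ(M) ≤ `Φ m` ≈ 0, as the gap at M is nonnegative. The same
    -- chain with the roles exchanged yields `gap≈0`.
    ℓ≈0 : ∀ S → lowerStandardization s S ≈ 0ℝ
    ℓ≈0 S = ≤-antisym
      (≤-trans (≤-respʳ-≈ (≈-reflexive (cong (lowerStandardization s) (S∪whole S)))
                 (lowerStandardization-mono s (restriction-𝒦 m∈𝒦) S whole))
        (≤-respʳ-≈ Φm≈0 (≤-respˡ-≈ (+-identityʳ _) (+-mono-≤ ≤-refl (gap≥0 whole)))))
      (ℓ≥0 S)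
    gap≈0 : ∀ S → gap m S ≈ 0ℝ
    gap≈0 S = ≤-antisym
      (≤-trans (≤-respʳ-≈ (≈-reflexive (cong (gap m) (S∪whole S)))
                 (monotone (gap-𝒦 m) (gap-∅ m) (gap-⁅⁆ m∈𝒦) S whole))
        (≤-respʳ-≈ Φm≈0 (≤-respˡ-≈ (+-identityˡ _) (+-mono-≤ (ℓ≥0 whole) ≤-refl))))
      (gap≥0 S)

    inside-x : ∀ S → x ∈ value S → m S - T l S ≈ 0ℝ
    inside-x S x∈S = ≈-trans
      (+-cong ≈-refl (-‿cong (≈-reflexive (trans (T-∈ l S x∈S) (cong m (widen-↾∪x S x∈S))))))
      (-‿inverseʳ (m S))

    outside-x : ∀ S → x ∉ value S → m S - T l S ≈ s ∅ - l ∅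
    outside-x S x∉S = ≈-trans
      (+-cong (≈-reflexive (cong m (sym (widen-↾-∉ S x∉S))))
              (-‿cong (≈-trans (≈-reflexive (T-∉ l S x∉S)) (modularPart≈ l (S ↾ M)))))
      -- Here s(S) is s(∅) minus the correction of s, and the corrections of s and l coincide at S,
      -- so only s(∅) - l(∅) survives.
      (≈-via (+-cong (ℓ≈0 (S ↾ M)) (-‿cong (gap≈0 (S ↾ M))))
        (solve 5 (λ sS s∅ l∅ cs cl → (sS :- (l∅ :- cl)) :- (s∅ :- l∅)
            := ((sS :- s∅ :+ cs) :- (cs :- cl)) :- (con 0ℚ :- con 0ℚ))
          ≈-refl (s (S ↾ M)) (s ∅) (l ∅) (correction s (S ↾ M)) (correction l (S ↾ M))))

  embedding : FaceEmbedding M N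
  embedding = record
    { T = T ; R = link ; Φ = Φ
    ; T-linear = T-linear ; R-linear = link-linear ; Φ-linear = Φ-linear
    ; T-𝒦 = T-𝒦 ; R-𝒦 = link-𝒦 ; R∘T = λ r S → ≈-reflexive (link-T r S)
    ; Φ-nonNeg = Φ-nonNeg ; Φ∘T = Φ-T ; T∘R = T-link
    }

  Extreme⇔ : ∀ r → Extreme M r ⇔ Extreme N (T r)
  Extreme⇔ r = mk⇔ (Extreme-T embedding {r})
    -- Extremality of `T r` includes its supermodularity, from which that of r is recovered first.
    λ ext → Extreme-T⁻ embedding {r} (Equivalence.to (T∈𝒦⇔ r) (proj₁ ext)) ext

  -- The independency model of the extension.

  private
    ↾-∪⁅x⁆ : ∀ B → (⁅x⁆ ∪ B) ↾ M ≡ B ↾ M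
    ↾-∪⁅x⁆ B = ↾-≡ (⁅x⁆ ∪ B) B
      (λ i∈M i∈ → [ (λ i∈x → ⊥-elim (∈M⇒≢x i∈M (x∈⁅y⁆⇒x≡y x i∈x))) , id ]′ (x∈p∪q⁻ Sub.⁅ x ⁆ (value B) i∈))
      (λ _ → q⊆p∪q Sub.⁅ x ⁆ (value B))

  module _ (r : SetFunction M) where

    -- The case to have in mind is U = abC, P = aC, Q = bC with a = x.
    mixed-difference : ∀ U C P Q → x ∈ value U → x ∉ value C → x ∈ value P → x ∉ value Q →
      P ↾ M ≡ C ↾ M → Q ↾ M ≡ U ↾ M →
      T r U + T r C - T r P - T r Q ≈ lowerStandardization r (U ↾ M) - lowerStandardization r (C ↾ M)
    mixed-difference U C P Q x∈U x∉C x∈P x∉Q P≡C Q≡U = ≈-trans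
      (+-cong (+-cong (+-cong (≈-reflexive (T-∈ r U x∈U)) (≈-reflexive (T-∉ r C x∉C)))
                      (-‿cong (≈-reflexive (trans (T-∈ r P x∈P) (cong r P≡C)))))
              (-‿cong (≈-reflexive (trans (T-∉ r Q x∉Q) (cong (modularPart r) Q≡U)))))
      (solve 4 (λ u ℓu c ℓc → u :+ (c :- ℓc) :- c :- (u :- ℓu) := ℓu :- ℓc) ≈-refl
        (r (U ↾ M)) (lowerStandardization r (U ↾ M)) (r (C ↾ M)) (lowerStandardization r (C ↾ M)))

    module _ (t : ℰ N) where
      open ℰ t

      private
        ℓ : SetFunction M
        ℓ = lowerStandardization r
        abC≡a∪[bC] : abC ≡ ⁅ a ⁆ ∪ (⁅ b ⁆ ∪ C)
        abC≡a∪[bC] = 𝒫-≡ (∪-assoc Sub.⁅ value a ⁆ Sub.⁅ value b ⁆ (value C))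
        abC≡b∪[aC] : abC ≡ ⁅ b ⁆ ∪ (⁅ a ⁆ ∪ C)
        abC≡b∪[aC] = trans (cong (_∪ C) (∪-comm-𝒫 ⁅ a ⁆ ⁅ b ⁆))
          (𝒫-≡ (∪-assoc Sub.⁅ value b ⁆ Sub.⁅ value a ⁆ (value C)))
        -- With the next identity, this turns the expression for a ⊥ b | C into the supermodular
        -- defect of the pair aC, bC.
        aC∪bC≡abC : (⁅ a ⁆ ∪ C) ∪ (⁅ b ⁆ ∪ C) ≡ abC
        aC∪bC≡abC = 𝒫-≡ (sym (∪-distribʳ-∪ Sub.⁅ value a ⁆ Sub.⁅ value b ⁆ (value C)))
        aC∩bC≡C : (⁅ a ⁆ ∪ C) ∩ (⁅ b ⁆ ∪ C) ≡ C
        aC∩bC≡C = 𝒫-≡ (trans (sym (∪-distribʳ-∩ (value C) Sub.⁅ value a ⁆ Sub.⁅ value b ⁆))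
          (trans (cong (Sub._∪ value C) (cong value (disjoint⇒∩≡∅ ⁅ a ⁆ ⁅ b ⁆ λ i∈a i∈b →
            a≢b (trans (sym (x∈⁅y⁆⇒x≡y (value a) i∈a)) (x∈⁅y⁆⇒x≡y (value b) i∈b)))))
            (∪-identityˡ (value C))))

        ∈a∪ : ∀ {B : 𝒫 N} → x ≡ value a → x ∈ value (⁅ a ⁆ ∪ B)
        ∈a∪ {B} refl = p⊆p∪q (value B) (x∈⁅x⁆ x)
        ∈b∪ : ∀ {B : 𝒫 N} → x ≡ value b → x ∈ value (⁅ b ⁆ ∪ B)
        ∈b∪ {B} refl = p⊆p∪q (value B) (x∈⁅x⁆ x)
        ∉∪ : ∀ {i} {B : Subset n} → x ≢ i → x ∉ B → x ∉ Sub.⁅ i ⁆ Sub.∪ B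
        ∉∪ {i} {B} x≢i x∉B = [ x≢i ∘ x∈⁅y⁆⇒x≡y i , x∉B ]′ ∘ x∈p∪q⁻ Sub.⁅ i ⁆ B
        ↾-drop : ∀ (i : Element N) B → x ≡ value i → (⁅ i ⁆ ∪ B) ↾ M ≡ B ↾ M
        ↾-drop i B refl = ↾-∪⁅x⁆ B

      independence-∉ : x ∉ value abC → t ∈ℐ T r
      independence-∉ x∉abC = ≈-via
        (≈-sym (≈-trans
          (T-modular-∉ r (⁅ a ⁆ ∪ C) (⁅ b ⁆ ∪ C)
            (x∉abC ∘ subst (x ∈_) (cong value aC∪bC≡abC) ∘ p⊆p∪q (value (⁅ b ⁆ ∪ C)))
            (x∉abC ∘ subst (x ∈_) (cong value aC∪bC≡abC) ∘ q⊆p∪q (value (⁅ a ⁆ ∪ C)) (value (⁅ b ⁆ ∪ C))))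
          (+-cong (≈-reflexive (cong (T r) aC∪bC≡abC)) (≈-reflexive (cong (T r) aC∩bC≡C)))))
        (solve 4 (λ u c p q → u :+ c :- p :- q :- con 0ℚ := (u :+ c) :- (p :+ q)) ≈-refl
          (T r abC) (T r C) (T r (⁅ a ⁆ ∪ C)) (T r (⁅ b ⁆ ∪ C)))

      -- Exactly two of the four sets contain x, and deleting x pairs them with C and bC (or aC).
      -- The values of r cancel, which leaves a difference of lower standardizations.
      independence-≡ : x ≡ value a ⊎ x ≡ value b → t ∈ℐ T r ⇔ ℓ (abC ↾ M) ≈ ℓ (C ↾ M)
      independence-≡ (inj₁ x≡a) = x-y≈0⇔x≈y
        (mixed-difference abC C (⁅ a ⁆ ∪ C) (⁅ b ⁆ ∪ C)
          (subst (λ U → x ∈ value U) (sym abC≡a∪[bC]) (∈a∪ {⁅ b ⁆ ∪ C} x≡a))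
          (λ x∈C → a∉C (subst (_∈ value C) x≡a x∈C))
          (∈a∪ {C} x≡a)
          (∉∪ (λ x≡b → a≢b (trans (sym x≡a) x≡b)) (λ x∈C → a∉C (subst (_∈ value C) x≡a x∈C)))
          (↾-drop a C x≡a)
          (sym (trans (cong (_↾ M) abC≡a∪[bC]) (↾-drop a (⁅ b ⁆ ∪ C) x≡a))))
      independence-≡ (inj₂ x≡b) = x-y≈0⇔x≈y (≈-trans
        -- The case x = b is the case x = a with the two subtracted terms exchanged.
        (solve 4 (λ u c p q → u :+ c :- p :- q := u :+ c :- q :- p) ≈-refl
          (T r abC) (T r C) (T r (⁅ a ⁆ ∪ C)) (T r (⁅ b ⁆ ∪ C)))
        (mixed-difference abC C (⁅ b ⁆ ∪ C) (⁅ a ⁆ ∪ C)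
          (subst (λ U → x ∈ value U) (sym abC≡b∪[aC]) (∈b∪ {⁅ a ⁆ ∪ C} x≡b))
          (λ x∈C → b∉C (subst (_∈ value C) x≡b x∈C))
          (∈b∪ {C} x≡b)
          (∉∪ (λ x≡a → a≢b (trans (sym x≡a) x≡b)) (λ x∈C → b∉C (subst (_∈ value C) x≡b x∈C)))
          (↾-drop b C x≡b)
          (sym (trans (cong (_↾ M) abC≡b∪[aC]) (↾-drop b (⁅ a ⁆ ∪ C) x≡b)))))

      -- All four sets contain x, so the defining expressions for `T r` and for r agree term by
      -- term.
      independence-∈ : (x∈C : x ∈ value C) → t ∈ℐ T r ⇔ dropFromC x t x∈C ∈ℐ r
      independence-∈ x∈C = mk⇔ (≈-trans (≈-sym E≈E′)) (≈-trans E≈E′)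
        where
        module t′ = ℰ (dropFromC x t x∈C)
        a↾ : ⁅ a ⁆ ↾ M ≡ ⁅ t′.a ⁆
        a↾ = widen-↾ ⁅ t′.a ⁆
        b↾ : ⁅ b ⁆ ↾ M ≡ ⁅ t′.b ⁆
        b↾ = widen-↾ ⁅ t′.b ⁆
        T-∪C : ∀ A {A′} → A ↾ M ≡ A′ → T r (A ∪ C) ≡ r (A′ ∪ t′.C)
        T-∪C A A↾≡A′ = trans (T-∪-∈ r A C (q⊆p∪q (value A) (value C) x∈C)) (cong (λ A′ → r (A′ ∪ t′.C)) A↾≡A′)
        E≈E′ : T r abC + T r C - T r (⁅ a ⁆ ∪ C) - T r (⁅ b ⁆ ∪ C) ≈
               r t′.abC + r t′.C - r (⁅ t′.a ⁆ ∪ t′.C) - r (⁅ t′.b ⁆ ∪ t′.C)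
        E≈E′ = +-cong (+-cong (+-cong
          (≈-reflexive (T-∪C (⁅ a ⁆ ∪ ⁅ b ⁆) (trans (↾-∪ ⁅ a ⁆ ⁅ b ⁆) (cong₂ _∪_ a↾ b↾))))
          (≈-reflexive (T-∈ r C x∈C)))
          (-‿cong (≈-reflexive (T-∪C ⁅ a ⁆ a↾))))
          (-‿cong (≈-reflexive (T-∪C ⁅ b ⁆ b↾)))

      -- The position of x relative to a, b and C is decidable, and each position is settled by one
      -- of the three preceding lemmas.
      independence :
        t ∈ℐ T r ⇔
          ( x ∉ value abC
          ⊎ ((x ≡ value a ⊎ x ≡ value b) × ℓ (abC ↾ M) ≈ ℓ (C ↾ M))
          ⊎ (Σ[ x∈C ∈ x ∈ value C ] dropFromC x t x∈C ∈ℐ r) )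
      independence = mk⇔ (to (x ∈? value C) (x Fin.≟ value a) (x Fin.≟ value b)) from
        where
        to : Dec (x ∈ value C) → Dec (x ≡ value a) → Dec (x ≡ value b) → t ∈ℐ T r → _
        to (yes x∈C) _ _ h = inj₂ (inj₂ (x∈C , Equivalence.to (independence-∈ x∈C) h))
        to (no _) (yes x≡a) _ h = inj₂ (inj₁ (inj₁ x≡a , Equivalence.to (independence-≡ (inj₁ x≡a)) h))
        to (no _) (no _) (yes x≡b) h = inj₂ (inj₁ (inj₂ x≡b , Equivalence.to (independence-≡ (inj₂ x≡b)) h))
        to (no x∉C) (no x≢a) (no x≢b) _ =
          inj₁ (∉∪ x≢a (∉∪ x≢b x∉C) ∘ subst (λ U → x ∈ value U) abC≡a∪[bC])
        from : _ → t ∈ℐ T r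
        from (inj₁ x∉abC) = independence-∉ x∉abC
        from (inj₂ (inj₁ (x≡ , h))) = Equivalence.from (independence-≡ x≡) h
        from (inj₂ (inj₂ (x∈C , h))) = Equivalence.from (independence-∈ x∈C) h

mainTheorem7 :
  ∀ {n : ℕ} (N : Subset n) → 2 ≤ℕ ∣ N ∣ →
  ∀ (x : Fin n) → x ∈ N →
  let M = N ∖ x in
  ∀ (r : SetFunction M) →
  let m : SetFunction N
      m = lowerModularExtension r
      rℓ = lowerStandardization r
  in
    ( (𝒦 N m ⇔ 𝒦 M r)
    × (𝒦 N m → ∀ (t : ℰ N) → let open ℰ t in
         t ∈ℐ m ⇔
           ( x ∉ value abC
           ⊎ ((x ≡ value a ⊎ x ≡ value b) × rℓ (abC ↾ M) ≈ rℓ (C ↾ M))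
           ⊎ (Σ[ x∈C ∈ x ∈ value C ] dropFromC x t x∈C ∈ℐ r) ) ) )
    × (Extreme M r ⇔ Extreme N m)
mainTheorem7 N _ x x∈N r = (T∈𝒦⇔ x∈N r , λ _ → independence x∈N r) , Extreme⇔ x∈N r
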